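{- Let $f$ be a gauge function such that $x^{ -1}f(x)$ is monotonically decreasing on $(0,\infty)$, and let $0\leq s<1$. Then the following are equivalent: (1) $H^f(\mathcal{D}_s)>0$; (2) $H^f(\mathcal{D}_{\leq s})>0$; (3) for every $r\in(s,1]$, it is not the case that $f(x)\leq^* x^r$.
   Context: $2^\omega$ is Cantor space of infinite binary sequences, $2^{<\omega}$ the set of finite binary strings; for $\sigma\in2^{<\omega}$, $[\sigma]=\{x\in2^\omega:\sigma\subseteq x\}$ and $|\sigma|$ is the length of $\sigma$. A gauge function is a continuous non-decreasing $f:\mathbb{R}^+\to\mathbb{R}^+$ with $\lim_{x\to0^+}f(x)=0$. For $A\subseteq2^\omega$, $H^f(A)=\lim_{n\to\infty}\inf\{\sum_i f(2^{ -|\sigma_i|}):\bigcup_i[\sigma_i]\supseteq A,\ \forall i\ |\sigma_i|\geq n\}$. For $f,g:\mathbb{R}^+\to\mathbb{R}^+$, $f(x)\leq^* g(x)$ means there is $\delta>0$ with $f(x)\leq g(x)$ for all $x\in(0,\delta)$. $K(\sigma)$ denotes the prefix-free Kolmogorov complexity of $\sigma$ (with respect to a fixed optimal prefix-free machine), and the effective dimension of $x\in2^\omega$ is $dim(x)=\liminf_{n\to\infty}K(x\upharpoonright n)/n$. For $0\le s\le1$, $\mathcal{D}_s=\{x\in2^\omega:dim(x)=s\}$ and $\mathcal{D}_{\leq s}=\{x\in2^\omega:dim(x)\leq s\}$. -}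

module Defs where

open import Algebra.Bundles using (CommutativeRing; Semiring)
open import Algebra.Structures using (IsCommutativeRing)
import Algebra.Definitions.RawSemiring as RawSemiringDefinitions
import Algebra.Properties.Ring as RingProperties
open import Axiom.ExcludedMiddle using (ExcludedMiddle)
open import Data.Bool.Base using (Bool; true; false)
open import Data.Fin.Base using (Fin; toℕ)
open import Data.List.Base using (List; []; _∷_; length; applyUpTo)
open import Data.List.Relation.Binary.Prefix.Heterogeneous using (Prefix)
open import Data.Nat.Base as ℕ using (ℕ; zero; suc; NonZero)
open import Data.Nat.Induction using (<-wellFounded; Acc; acc)
open import Data.Nat.Properties using (≮⇒≥)
open import Data.Product.Base using (∃; ∃-syntax; _×_; _,_; proj₁; proj₂)
open import Data.Sum.Base using (_⊎_; inj₁; inj₂)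
open import Data.Vec.Base using (Vec; []; _∷_; lookup)
open import Data.Vec.Relation.Binary.Pointwise.Inductive as Vec using ([]; _∷_)
open import Level using (0ℓ)
open import Relation.Binary.Core using (Rel)
open import Relation.Binary.PropositionalEquality.Core using (_≡_; refl; sym; trans)
import Relation.Binary.Construct.Add.Extrema.Equality as ExtremaEquality
import Relation.Binary.Construct.Add.Extrema.NonStrict as ExtremaNonStrict
import Relation.Binary.Construct.Add.Extrema.Strict as ExtremaStrict
import Relation.Binary.Construct.Add.Supremum.NonStrict as SupremumNonStrict
import Relation.Binary.Construct.NonStrictToStrict as NonStrictToStrict
open import Relation.Binary.Structures using (IsTotalOrder)
open import Relation.Nullary using (¬_; yes; no; contradiction)
open import Relation.Nullary.Construct.Add.Extrema using (_±; [_]; ⊥±; ⊤±)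
open import Relation.Unary using (Pred)

String : Set
String = List Bool

Cantor : Set
Cantor = ℕ → Bool

_↾_ : Cantor → ℕ → String
x ↾ n = applyUpTo x n

_∈⟦_⟧ : Cantor → String → Set
x ∈⟦ σ ⟧ = x ↾ length σ ≡ σ

data Rec : ℕ → Set where
  zero : Rec 0
  succ : Rec 1
  proj : ∀ {n} → Fin n → Rec n
  comp : ∀ {m n} → Rec m → Vec (Rec n) m → Rec n
  prec : ∀ {n} → Rec n → Rec (2 ℕ.+ n) → Rec (suc n)
  mu   : ∀ {n} → Rec (suc n) → Rec n

infix 4 _·_⇓_

data _·_⇓_ : ∀ {n} → Rec n → Vec ℕ n → ℕ → Set where
  zero⇓ : zero · [] ⇓ 0
  succ⇓ : ∀ {x} → succ · (x ∷ []) ⇓ suc x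
  proj⇓ : ∀ {n} {i : Fin n} {xs} → proj i · xs ⇓ lookup xs i
  comp⇓ : ∀ {m n} {f : Rec m} {gs : Vec (Rec n) m} {xs ys z} →
          Vec.Pointwise (λ g y → g · xs ⇓ y) gs ys →
          f · ys ⇓ z → comp f gs · xs ⇓ z
  prec⇓-zero : ∀ {n} {f : Rec n} {g xs y} →
          f · xs ⇓ y → prec f g · (0 ∷ xs) ⇓ y
  prec⇓-suc : ∀ {n} {f : Rec n} {g k xs y z} →
          prec f g · (k ∷ xs) ⇓ y → g · (k ∷ y ∷ xs) ⇓ z →
          prec f g · (suc k ∷ xs) ⇓ z
  mu⇓ : ∀ {n} {f : Rec (suc n)} {xs k} →
          (∀ j → j ℕ.< k → ∃[ v ] (f · (j ∷ xs) ⇓ suc v)) →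
          f · (k ∷ xs) ⇓ 0 → mu f · xs ⇓ k

-- A computable bijection between strings and numbers.
code : String → ℕ
code []          = 0
code (false ∷ σ) = 1 ℕ.+ 2 ℕ.* code σ
code (true ∷ σ)  = 2 ℕ.+ 2 ℕ.* code σ

Machine : Set
Machine = Rec 1

infix 4 _⟨_⟩↓_

_⟨_⟩↓_ : Machine → String → String → Set
M ⟨ τ ⟩↓ σ = M · (code τ ∷ []) ⇓ code σ

PrefixFree : Machine → Set
PrefixFree M = ∀ τ τ′ σ σ′ → M ⟨ τ ⟩↓ σ → M ⟨ τ′ ⟩↓ σ′ →
               Prefix _≡_ τ τ′ → τ ≡ τ′

Optimal : Machine → Set
Optimal U = ∀ M → PrefixFree M → ∃[ c ] (∀ τ σ → M ⟨ τ ⟩↓ σ →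
            ∃[ τ′ ] (U ⟨ τ′ ⟩↓ σ × length τ′ ℕ.≤ length τ ℕ.+ c))

record OptimalPrefixFreeMachine : Set where
  field
    machine    : Machine
    prefixFree : PrefixFree machine
    optimal    : Optimal machine

private
  const : ℕ → Machine
  const zero    = comp zero []
  const (suc n) = comp succ (const n ∷ [])

  const⇓ : ∀ n {x} → const n · (x ∷ []) ⇓ n
  const⇓ zero    = comp⇓ [] zero⇓
  const⇓ (suc n) = comp⇓ (const⇓ n ∷ []) succ⇓

  -- Defined only at 0, the code of the empty string.
  atZero : Machine
  atZero = mu (proj (Fin.suc Fin.zero))

  atZero⇓ : atZero · (0 ∷ []) ⇓ 0
  atZero⇓ = mu⇓ (λ _ ()) proj⇓

  proj-value : ∀ {n i xs y} → proj {n} i · xs ⇓ y → y ≡ lookup xs i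
  proj-value proj⇓ = refl

  atZero-domain : ∀ {x y} → atZero · (x ∷ []) ⇓ y → x ≡ 0
  atZero-domain (mu⇓ _ p) = sym (proj-value p)

  code≡0 : ∀ τ → code τ ≡ 0 → τ ≡ []
  code≡0 []          _  = refl
  code≡0 (false ∷ _) ()
  code≡0 (true ∷ _)  ()

  constantly : String → Machine
  constantly σ = comp (const (code σ)) (atZero ∷ [])

  constantly-domain : ∀ σ τ ρ → constantly σ ⟨ τ ⟩↓ ρ → τ ≡ []
  constantly-domain σ τ ρ (comp⇓ (p ∷ []) _) = code≡0 τ (atZero-domain p)

  constantly-prefixFree : ∀ σ → PrefixFree (constantly σ)
  constantly-prefixFree σ τ τ′ ρ ρ′ p q _ =
    trans (constantly-domain σ τ ρ p) (sym (constantly-domain σ τ′ ρ′ q))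

DescriptionLength : Machine → String → Pred ℕ 0ℓ
DescriptionLength U σ n = ∃[ τ ] (U ⟨ τ ⟩↓ σ × length τ ≡ n)

describable : (U : OptimalPrefixFreeMachine) (σ : String) →
              ∃ (DescriptionLength (OptimalPrefixFreeMachine.machine U) σ)
describable U σ
  with (_ , simulate) ← OptimalPrefixFreeMachine.optimal U (constantly σ) (constantly-prefixFree σ)
  with (τ , p , _) ← simulate [] σ (comp⇓ (atZero⇓ ∷ []) (const⇓ (code σ)))
  = length τ , τ , p , refl

-- The real numbers, up to isomorphism.
record CompleteOrderedField : Set₁ where
  infix  9 _⁻¹
  infixl 7 _*_
  infixl 6 _+_
  infix  4 _≈_ _≤_
  field
    Carrier           : Set
    _≈_ _≤_           : Rel Carrier 0ℓ
    _+_ _*_           : Carrier → Carrier → Carrier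
    -_                : Carrier → Carrier
    0# 1#             : Carrier
    isCommutativeRing : IsCommutativeRing _≈_ _+_ _*_ -_ 0# 1#
    isTotalOrder      : IsTotalOrder _≈_ _≤_
    0≉1               : ¬ 0# ≈ 1#
    -- The value of 0# ⁻¹ is unspecified.
    _⁻¹               : Carrier → Carrier
    ⁻¹-inverseʳ       : ∀ {x} → ¬ x ≈ 0# → x * x ⁻¹ ≈ 1#
    +-monoˡ-≤         : ∀ z {x y} → x ≤ y → x + z ≤ y + z
    *-nonNegative     : ∀ {x y} → 0# ≤ x → 0# ≤ y → 0# ≤ x * y

  IsUpperBound : Pred Carrier 0ℓ → Pred Carrier 0ℓ
  IsUpperBound P b = ∀ x → P x → x ≤ b

  field
    complete : (P : Pred Carrier 0ℓ) → ∃ P → ∃ (IsUpperBound P) →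
               ∃[ l ] (IsUpperBound P l × (∀ b → IsUpperBound P b → l ≤ b))

  commutativeRing : CommutativeRing 0ℓ 0ℓ
  commutativeRing = record { isCommutativeRing = isCommutativeRing }

  private
    module CR = CommutativeRing commutativeRing
    module RP = RingProperties CR.ring

  open CR public using (_-_)
  open NonStrictToStrict _≈_ _≤_ public using (_<_)
  open RawSemiringDefinitions (Semiring.rawSemiring CR.semiring) public
    using (_^_; sum) renaming (_×_ to _×ℕ_)
  open IsTotalOrder isTotalOrder using (total; antisym; reflexive) renaming (trans to ≤-trans)

  fromℕ : ℕ → Carrier
  fromℕ n = n ×ℕ 1#

  infixl 7 _/_
  _/_ : Carrier → (n : ℕ) → .{{NonZero n}} → Carrier
  x / n = x * fromℕ n ⁻¹

  ∣_∣ : Carrier → Carrier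
  ∣ x ∣ with total 0# x
  ... | inj₁ _ = x
  ... | inj₂ _ = - x

  private
    ≤-respˡ : ∀ {x y z} → x ≈ y → x ≤ z → y ≤ z
    ≤-respˡ x≈y x≤z = ≤-trans (reflexive (CR.sym x≈y)) x≤z

    ≤-respʳ : ∀ {x y z} → x ≈ y → z ≤ x → z ≤ y
    ≤-respʳ x≈y z≤x = ≤-trans z≤x (reflexive x≈y)

    x≤x+y : ∀ {x y} → 0# ≤ y → x ≤ x + y
    x≤x+y {x} {y} 0≤y =
      ≤-respˡ (CR.+-identityˡ x) (≤-respʳ (CR.+-comm y x) (+-monoˡ-≤ x 0≤y))

    0≤-x : ∀ {x} → x ≤ 0# → 0# ≤ - x
    0≤-x {x} x≤0 =
      ≤-respˡ (CR.-‿inverseʳ x) (≤-respʳ (CR.+-identityˡ (- x)) (+-monoˡ-≤ (- x) x≤0))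

  0≤1 : 0# ≤ 1#
  0≤1 with total 0# 1#
  ... | inj₁ 0≤1 = 0≤1
  ... | inj₂ 1≤0 = ≤-respʳ (CR.trans (RP.-1*x≈-x (- 1#)) (RP.-‿involutive 1#))
                           (*-nonNegative (0≤-x 1≤0) (0≤-x 1≤0))

  fromℕ-nonNegative : ∀ n → 0# ≤ fromℕ n
  fromℕ-nonNegative zero    = reflexive CR.refl
  fromℕ-nonNegative (suc n) = ≤-trans 0≤1 (x≤x+y (fromℕ-nonNegative n))

  fromℕ-nonZero : ∀ n → ¬ fromℕ (suc n) ≈ 0#
  fromℕ-nonZero n n≈0 = 0≉1 (antisym 0≤1 (≤-respʳ n≈0 (x≤x+y (fromℕ-nonNegative n))))

  ⁻¹-nonNegative : ∀ {x} → 0# ≤ x → ¬ x ≈ 0# → 0# ≤ x ⁻¹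
  ⁻¹-nonNegative {x} 0≤x x≉0 with total 0# (x ⁻¹)
  ... | inj₁ 0≤x⁻¹ = 0≤x⁻¹
  ... | inj₂ x⁻¹≤0 = contradiction (antisym 0≤1 1≤0) 0≉1
    where
    0≤-1 : 0# ≤ - 1#
    0≤-1 = ≤-respʳ (CR.trans (CR.sym (RP.-‿distribʳ-* x (x ⁻¹))) (CR.-‿cong (⁻¹-inverseʳ x≉0)))
                   (*-nonNegative 0≤x (0≤-x x⁻¹≤0))
    1≤0 : 1# ≤ 0#
    1≤0 = ≤-respʳ (CR.-‿inverseʳ 1#) (x≤x+y 0≤-1)

  ^-nonNegative : ∀ {x} → 0# ≤ x → ∀ n → 0# ≤ x ^ n
  ^-nonNegative 0≤x zero    = 0≤1
  ^-nonNegative 0≤x (suc n) = *-nonNegative 0≤x (^-nonNegative 0≤x n)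

  ℝ⁺ : Set
  ℝ⁺ = ∃[ x ] (0# ≤ x)

  2^-_ : ℕ → ℝ⁺
  2^- n = fromℕ 2 ⁻¹ ^ n ,
          ^-nonNegative (⁻¹-nonNegative (fromℕ-nonNegative 2) (fromℕ-nonZero 1)) n

-- Excluded middle makes suprema of arbitrary sets available.  Without it the
-- classical theory also fails: if every x : Cantor is computable, then every x
-- has effective dimension 0.
module Classical (em : ExcludedMiddle 0ℓ) (𝓡 : CompleteOrderedField) where

  open CompleteOrderedField 𝓡 renaming (Carrier to ℝ)
  open IsTotalOrder isTotalOrder using (reflexive)

  ℝ± : Set
  ℝ± = ℝ ±

  open ExtremaEquality _≈_ public using (_≈±_)
  open ExtremaNonStrict _≤_ public using (_≤±_; _≤⊤±; ⊥±≤_; [≤]-injective) renaming ([_] to ≤[_])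
  open ExtremaStrict _<_ public using (_<±_)

  sup : Pred ℝ± 0ℓ → ℝ±
  sup P with em {∃[ b ] (∀ y → P y → y ≤± [ b ])}
  ... | no _        = ⊤±
  ... | yes (b , h) with em {∃[ x ] P [ x ]}
  ...   | no _  = ⊥±
  ...   | yes p = [ proj₁ (complete (λ x → P [ x ]) p (b , λ x px → [≤]-injective (h [ x ] px))) ]

  inf : Pred ℝ± 0ℓ → ℝ±
  inf P = sup λ l → ∀ y → P y → l ≤± y

  sup-upper : ∀ P y → P y → y ≤± sup P
  sup-upper P y py with em {∃[ b ] (∀ y → P y → y ≤± [ b ])}
  ... | no _        = y ≤⊤±
  ... | yes (b , h) with em {∃[ x ] P [ x ]}
  sup-upper P ⊥±    py | yes _       | no _  = ⊥±≤ ⊥±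
  sup-upper P [ x ] py | yes _       | no ¬p = contradiction (x , py) ¬p
  sup-upper P ⊤±    py | yes (b , h) | no _  with () ← h ⊤± py
  sup-upper P ⊥±    py | yes _       | yes _ = ⊥±≤ _
  sup-upper P [ x ] py | yes (b , h) | yes p =
    ≤[ proj₁ (proj₂ (complete (λ x → P [ x ]) p (b , λ x px → [≤]-injective (h [ x ] px)))) x py ]
  sup-upper P ⊤±    py | yes (b , h) | yes _ with () ← h ⊤± py

  sup-least : ∀ P b → (∀ y → P y → y ≤± b) → sup P ≤± b
  sup-least P b h with em {∃[ b ] (∀ y → P y → y ≤± [ b ])}
  sup-least P ⊥±    h | no ¬q = contradiction (0# , λ y py → bot (h y py)) ¬q
    where
    bot : ∀ {y} → y ≤± ⊥± → y ≤± [ 0# ]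
    bot {⊥±} _ = ⊥±≤ _
    bot {[ _ ]} (SupremumNonStrict.[ () ])
  sup-least P [ b ] h | no ¬q = contradiction (b , h) ¬q
  sup-least P ⊤±    h | no _  = ⊤± ≤⊤±
  sup-least P b     h | yes _ with em {∃[ x ] P [ x ]}
  sup-least P b     h | yes _ | no _ = ⊥±≤ b
  sup-least P ⊥±    h | yes _ | yes (x , px) with SupremumNonStrict.[ () ] ← h [ x ] px
  sup-least P [ b ] h | yes _ | yes p =
    ≤[ proj₂ (proj₂ (complete _ p _)) b (λ x px → [≤]-injective (h [ x ] px)) ]
  sup-least P ⊤±    h | yes _ | yes _ = _ ≤⊤±

  ⨆ ⨅ : (ℕ → ℝ±) → ℝ±
  ⨆ a = sup λ y → ∃[ n ] (y ≡ a n)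
  ⨅ a = inf λ y → ∃[ n ] (y ≡ a n)

  liminf : (ℕ → ℝ±) → ℝ±
  liminf a = ⨆ λ n → ⨅ λ k → a (n ℕ.+ k)

  -- The supremum of a bounded set of nonnegative reals, 0# if it is empty.
  -- The value 0# for unbounded sets is a convention.
  sup⁺ : Pred ℝ⁺ 0ℓ → ℝ⁺
  sup⁺ P with em {∃[ b ] (0# ≤ b × (∀ y → P y → proj₁ y ≤ b))}
  ... | no _ = 0# , reflexive (CommutativeRing.refl commutativeRing)
  ... | yes (b , 0≤b , h)
    with (l , upper , _) ← complete (λ x → x ≈ 0# ⊎ ∃[ 0≤x ] P (x , 0≤x))
                             (0# , inj₁ (CommutativeRing.refl commutativeRing))
                             (b , λ where x (inj₁ x≈0)       → IsTotalOrder.trans isTotalOrder (reflexive x≈0) 0≤b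
                                          x (inj₂ (0≤x , p)) → h (x , 0≤x) p)
    = l , upper 0# (inj₁ (CommutativeRing.refl commutativeRing))

  -- For r ≥ 0, the supremum of the rational powers x ^ p/q with p/q ≤ r if
  -- x ≥ 1, and with p/q ≥ r if x ≤ 1; roots are avoided by using that
  -- y ≤ x ^ p/q if and only if y ^ q ≤ x ^ p.  Not meaningful for r < 0.
  infixr 8 _^ʳ_
  _^ʳ_ : ℝ⁺ → ℝ → ℝ⁺
  (x , _) ^ʳ r = sup⁺ λ (y , _) → ∃[ p ] ∃[ q-1 ]
    let q   = suc q-1
        p/q = fromℕ p / q
    in (1# ≤ x × p/q ≤ r ⊎ x ≤ 1# × r ≤ p/q) × y ^ q ≤ x ^ p

  record IsGauge (f : ℝ⁺ → ℝ⁺) : Set where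
    field
      continuous : ∀ x ε → 0# < ε → ∃[ δ ] (0# < δ × (∀ y →
                   ∣ proj₁ y - proj₁ x ∣ < δ → ∣ proj₁ (f y) - proj₁ (f x) ∣ < ε))
      monotone   : ∀ x y → proj₁ x ≤ proj₁ y → proj₁ (f x) ≤ proj₁ (f y)
      -- f is nonnegative, so its absolute value is not needed here.
      vanishing  : ∀ ε → 0# < ε → ∃[ δ ] (0# < δ × (∀ x →
                   0# < proj₁ x → proj₁ x < δ → proj₁ (f x) < ε))

  QuotientDecreasing : (ℝ⁺ → ℝ⁺) → Set
  QuotientDecreasing f = ∀ x y → 0# < proj₁ x → proj₁ x ≤ proj₁ y →
                         proj₁ y ⁻¹ * proj₁ (f y) ≤ proj₁ x ⁻¹ * proj₁ (f x)

  infix 4 _≤*_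
  _≤*_ : (ℝ⁺ → ℝ⁺) → (ℝ⁺ → ℝ⁺) → Set
  f ≤* g = ∃[ δ ] (0# < δ × (∀ x → 0# < proj₁ x → proj₁ x < δ → proj₁ (f x) ≤ proj₁ (g x)))

  Covers : (ℕ → String) → Pred Cantor 0ℓ → Set
  Covers σ A = ∀ x → A x → ∃[ i ] x ∈⟦ σ i ⟧

  -- Only for nonnegative terms is this the sum of the series.
  ∑ : (ℕ → ℝ⁺) → ℝ±
  ∑ a = ⨆ λ n → [ sum {n} (λ i → proj₁ (a (toℕ i))) ]

  premeasure : (ℝ⁺ → ℝ⁺) → ℕ → Pred Cantor 0ℓ → ℝ±
  premeasure f n A = inf λ v → ∃[ σ ] (Covers σ A × (∀ i → n ℕ.≤ length (σ i)) ×
                     v ≡ ∑ λ i → f (2^- length (σ i)))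

  -- The premeasures increase with n, so their limit is their supremum.
  H : (ℝ⁺ → ℝ⁺) → Pred Cantor 0ℓ → ℝ±
  H f A = ⨆ λ n → premeasure f n A

  private
    least : (P : Pred ℕ 0ℓ) → ∀ n → Acc ℕ._<_ n → P n →
            ∃[ m ] (P m × (∀ k → P k → m ℕ.≤ k))
    least P n (acc rec) pn with em {∃[ k ] (k ℕ.< n × P k)}
    ... | yes (k , k<n , pk) = least P k (rec k<n) pk
    ... | no  none           = n , pn , λ k pk → ≮⇒≥ λ k<n → none (k , k<n , pk)

  module Dimension (U : OptimalPrefixFreeMachine) where

    open OptimalPrefixFreeMachine U

    shortest : ∀ σ → ∃[ n ] (DescriptionLength machine σ n × (∀ k → DescriptionLength machine σ k → n ℕ.≤ k))
    shortest σ = least (DescriptionLength machine σ) _ (<-wellFounded _) (proj₂ (describable U σ))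

    K : String → ℕ
    K σ = proj₁ (shortest σ)

    -- Indexed from n = 1, as K (x ↾ n) / n is undefined at n = 0.
    dim : Cantor → ℝ±
    dim x = liminf λ n → [ fromℕ (K (x ↾ suc n)) / suc n ]

    𝓓 𝓓≤ : ℝ → Pred Cantor 0ℓ
    𝓓  s x = dim x ≈± [ s ]
    𝓓≤ s x = dim x ≤± [ s ]

{-# OPTIONS --safe #-}

-- Covering 𝓓≤ s by the strings σ with K(σ) < t|σ|, where s < t < r, Kraft's
-- inequality bounds Σ 2^(-r|σ|) over |σ| ≥ n by 2^(-(r - t)n); hence H f (𝓓≤ s)
-- is zero if f(x) ≤* x^r for some r > s.
--
-- Otherwise f(2^-n) ≥ 2^(-tn) for infinitely many n, for every t > s.  Choose a very
-- sparse sequence n₀ < n₁ < … of such n, with t → s, put b_k ≈ t n_k, and call the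
-- first b_(k+1) - b_k positions of each interval [n_k , n_(k+1)) free.  Let the free
-- bits of a point be independent and uniform, and the others zero.  As f(x)/x is
-- decreasing, the mass of every ⟦ σ ⟧ is at most a constant times f(2^-|σ|), so the
-- sum of a cover of a set of positive mass is bounded below.  The free positions
-- below n_k lie in an initial segment of length about s n_k, so the dimension is at
-- most s; by Kraft's inequality, at least half of the mass consists of points x such
-- that K(x ↾ n) is at least the number of free positions below n, which is at least
-- sn, for all n.
module Submission where

open import Defs
open import Algebra.Bundles using (CommutativeRing)
import Algebra.Properties.CommutativeMonoid.Sum as Sum
import Algebra.Properties.CommutativeSemigroup as CommutativeSemigroupProperties
import Algebra.Properties.Semiring.Exp as Exp
import Algebra.Properties.Semiring.Mult as Mult
open import Axiom.ExcludedMiddle using (ExcludedMiddle)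
open import Data.Bool.Base using (Bool; true; false)
open import Data.Bool.Properties using (¬-not)
open import Data.Fin.Base using (toℕ)
open import Data.List.Base using ([]; _∷_; _∷ʳ_; _++_; drop; length; replicate; take)
open import Data.List.Properties
  using (applyUpTo-∷ʳ; length-++; length-applyUpTo; length-replicate; length-take)
open import Data.List.Relation.Binary.Prefix.Heterogeneous using (Prefix; []; _∷_)
open import Data.Nat.Base as ℕ using (ℕ; zero; suc; z≤n; s≤s)
import Data.Nat.DivMod as ℕ
import Data.Nat.Properties as ℕ
open import Data.Product.Base using (_×_; ∃-syntax; _,_; proj₁; proj₂)
open import Data.Sum.Base as ⊎ using (inj₁; inj₂)
open import Function.Base using (_∘_)
open import Function.Bundles using (_⇔_; mk⇔)
open import Level using (0ℓ)
open import Relation.Binary.Bundles using (Poset)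
import Relation.Binary.Construct.Add.Extrema.NonStrict as ExtremaNonStrict
import Relation.Binary.Construct.Add.Extrema.Strict as ExtremaStrict
import Relation.Binary.Construct.Add.Supremum.NonStrict as SupremumNonStrict
import Relation.Binary.PropositionalEquality as ≡
open ≡ using (_≡_)
import Relation.Binary.Reasoning.PartialOrder as PartialOrderReasoning
open import Relation.Binary.Structures using (IsTotalOrder)
open import Relation.Nullary using (¬_; Dec; yes; no; contradiction; does)
open import Relation.Nullary.Construct.Add.Extrema using ([_]; ⊥±; ⊤±)
open import Relation.Unary using (_⊆_)

-- Having the free bits at the front of a block serves both bounds on the dimension. A description
-- of a prefix cannot compute which positions are free, since these are chosen by excluded middle
-- from an arbitrary `f` and a real `s`. It need only list an initial segment that contains the free
-- positions below its length, and append zeros; for this a machine with two fixed integers `P` and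
-- `Q` is enough. On the other hand, throughout the rest of the block the count already has the
-- value needed at the end of the block, so it is at least `s` times the length at every position,
-- as a limit inferior demands. While bits are being spent, the bound on the mass survives because
-- f(2^-n) is at most halved when n grows by one. No measure on Cantor space is constructed: `mass`
-- is additive on strings, and the cover and the strings of too low complexity form one family of
-- weights to which a compactness argument applies. Real exponents are only ever compared with
-- fractions, through integral powers of 1/2.

-- Strings as numbers in bijective binary notation.

module Strings where

  open import Data.Nat.Base
  open import Data.Nat.Properties
  open ≡

  code-injective : ∀ σ τ → code σ ≡ code τ → σ ≡ τ
  code-injective []          []          _  = refl
  code-injective []          (false ∷ τ) ()
  code-injective []          (true ∷ τ)  ()
  code-injective (false ∷ σ) []          ()
  code-injective (true ∷ σ)  []          ()
  code-injective (false ∷ σ) (false ∷ τ) eq =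
    cong (false ∷_) (code-injective σ τ (*-cancelˡ-≡ _ _ 2 (suc-injective eq)))
  code-injective (true ∷ σ)  (true ∷ τ)  eq =
    cong (true ∷_) (code-injective σ τ (*-cancelˡ-≡ _ _ 2 (suc-injective (suc-injective eq))))
  code-injective (false ∷ σ) (true ∷ τ)  eq =
    contradiction (trans (suc-injective eq) refl) (even≢odd (code σ) (code τ))
  code-injective (true ∷ σ)  (false ∷ τ) eq =
    contradiction (sym (suc-injective eq)) (even≢odd (code τ) (code σ))

  next : String → String
  next []          = false ∷ []
  next (false ∷ σ) = true ∷ σ
  next (true ∷ σ)  = false ∷ next σ

  code-next : ∀ σ → code (next σ) ≡ suc (code σ)
  code-next []          = refl
  code-next (false ∷ σ) = refl
  code-next (true ∷ σ)  = cong suc (trans (cong (2 *_) (code-next σ)) (*-suc 2 (code σ)))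

  decode : ℕ → String
  decode zero    = []
  decode (suc n) = next (decode n)

  code-decode : ∀ n → code (decode n) ≡ n
  code-decode zero    = refl
  code-decode (suc n) = trans (code-next (decode n)) (cong suc (code-decode n))

  decode-code : ∀ σ → decode (code σ) ≡ σ
  decode-code σ = code-injective _ _ (code-decode (code σ))

  -- With `suc[code]<2^`, this places `suc (code σ)` between consecutive powers of 2, so that a
  -- machine can test the length of a string by arithmetic on its code.
  2^length≤ : ∀ σ → 2 ^ length σ ≤ suc (code σ)
  2^length≤ []          = ≤-refl
  2^length≤ (false ∷ σ) = ≤-trans (*-monoʳ-≤ 2 (2^length≤ σ)) (≤-reflexive (*-suc 2 (code σ)))
  2^length≤ (true ∷ σ)  =
    ≤-trans (*-monoʳ-≤ 2 (2^length≤ σ)) (≤-trans (≤-reflexive (*-suc 2 (code σ))) (n≤1+n _))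

  suc[code]<2^ : ∀ σ → suc (suc (code σ)) ≤ 2 ^ suc (length σ)
  suc[code]<2^ = bound
    where
    bound : ∀ σ → 2 + code σ ≤ 2 * 2 ^ length σ
    twice : ∀ σ → 4 + 2 * code σ ≤ 2 * (2 * 2 ^ length σ)
    twice σ = ≤-trans (≤-reflexive (sym (*-distribˡ-+ 2 2 (code σ)))) (*-monoʳ-≤ 2 (bound σ))
    bound []          = ≤-refl
    bound (true ∷ σ)  = twice σ
    bound (false ∷ σ) = ≤-trans (n≤1+n _) (twice σ)

  -- The first bit is the least significant, and a digit `false` at position i contributes 2^i. The
  -- new digits add a geometric sum that depends on the lengths only, so padding is an addition of
  -- numbers.
  code-pad : ∀ ρ j → code (ρ ++ replicate j false) + 2 ^ length ρ ≡ code ρ + 2 ^ (length ρ + j)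
  code-pad [] zero    = refl
  code-pad [] (suc j) = begin
    suc (2 * c) + 1     ≡⟨ +-comm (suc (2 * c)) 1 ⟩
    2 + 2 * c           ≡⟨ *-distribˡ-+ 2 1 c ⟨
    2 * (1 + c)         ≡⟨ cong (2 *_) (+-comm 1 c) ⟩
    2 * (c + 1)         ≡⟨ cong (2 *_) (code-pad [] j) ⟩
    2 * 2 ^ j           ∎
    where
    open ≡-Reasoning
    c = code (replicate j false)
  code-pad (b ∷ ρ) j = step b
    where
    open ≡-Reasoning
    c = code (ρ ++ replicate j false)
    double : 2 * c + 2 ^ suc (length ρ) ≡ 2 * code ρ + 2 ^ suc (length ρ + j)
    double = begin
      2 * c + 2 * 2 ^ length ρ            ≡⟨ *-distribˡ-+ 2 c (2 ^ length ρ) ⟨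
      2 * (c + 2 ^ length ρ)              ≡⟨ cong (2 *_) (code-pad ρ j) ⟩
      2 * (code ρ + 2 ^ (length ρ + j))   ≡⟨ *-distribˡ-+ 2 (code ρ) _ ⟩
      2 * code ρ + 2 ^ suc (length ρ + j) ∎
    step : ∀ b → code (b ∷ ρ ++ replicate j false) + 2 ^ suc (length ρ) ≡
                 code (b ∷ ρ) + 2 ^ suc (length ρ + j)
    step false = cong suc double
    step true  = cong (2 +_) double

  data Comparable (σ τ : String) : Set where
    is-prefix : Prefix _≡_ σ τ → Comparable σ τ
    has-prefix : Prefix _≡_ τ σ → Comparable σ τ

  prefixes-comparable : ∀ {σ τ υ} → Prefix _≡_ σ υ → Prefix _≡_ τ υ → Comparable σ τ
  prefixes-comparable []         _          = is-prefix []
  prefixes-comparable (_ ∷ _)    []         = has-prefix []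
  prefixes-comparable (refl ∷ p) (refl ∷ q) with prefixes-comparable p q
  ... | is-prefix r = is-prefix (refl ∷ r)
  ... | has-prefix r = has-prefix (refl ∷ r)

-- Recursive functions and a machine that pads with zeros.

module Recursive where

  open import Data.Fin.Base using (zero; suc)
  open import Data.Nat.Base
  open import Data.Nat.Properties
  open import Data.Vec.Base using (Vec; []; _∷_)
  open import Data.Vec.Relation.Binary.Pointwise.Inductive as Vec using ([]; _∷_)
  open import Relation.Binary.Definitions using (tri<; tri≈; tri>)
  open ≡

  open Strings

  ⇓-deterministic : ∀ {n} (r : Rec n) {xs y z} → r · xs ⇓ y → r · xs ⇓ z → y ≡ z
  ⇓*-deterministic : ∀ {m n} (gs : Vec (Rec n) m) {xs ys zs} →
                     Vec.Pointwise (λ g y → g · xs ⇓ y) gs ys →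
                     Vec.Pointwise (λ g z → g · xs ⇓ z) gs zs → ys ≡ zs
  ⇓-deterministic zero       zero⇓           zero⇓           = refl
  ⇓-deterministic succ       succ⇓           succ⇓           = refl
  ⇓-deterministic (proj i)   proj⇓           proj⇓           = refl
  ⇓-deterministic (comp f gs) (comp⇓ ps p)   (comp⇓ qs q)
    with refl ← ⇓*-deterministic gs ps qs    = ⇓-deterministic f p q
  ⇓-deterministic (prec f g) (prec⇓-zero p)  (prec⇓-zero q)  = ⇓-deterministic f p q
  ⇓-deterministic (prec f g) (prec⇓-suc p q) (prec⇓-suc p′ q′)
    with refl ← ⇓-deterministic (prec f g) p p′ = ⇓-deterministic g q q′
  ⇓-deterministic (mu f) {y = y} {z} (mu⇓ before p) (mu⇓ before′ p′) with <-cmp y z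
  ... | tri≈ _ y≡z _ = y≡z
  ... | tri< y<z _ _ = contradiction (⇓-deterministic f p (proj₂ (before′ y y<z))) 0≢1+n
  ... | tri> _ _ z<y = contradiction (⇓-deterministic f p′ (proj₂ (before z z<y))) 0≢1+n
  ⇓*-deterministic []       []       []       = refl
  ⇓*-deterministic (g ∷ gs) (p ∷ ps) (q ∷ qs) =
    cong₂ _∷_ (⇓-deterministic g p q) (⇓*-deterministic gs ps qs)

  ⇓-value : ∀ {n} {r : Rec n} {xs y z} → y ≡ z → r · xs ⇓ y → r · xs ⇓ z
  ⇓-value refl p = p

  constR : ∀ {n} → ℕ → Rec n
  constR zero    = comp zero []
  constR (suc k) = comp succ (constR k ∷ [])

  constR⇓ : ∀ {n} k {xs : Vec ℕ n} → constR k · xs ⇓ k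
  constR⇓ zero    = comp⇓ [] zero⇓
  constR⇓ (suc k) = comp⇓ (constR⇓ k ∷ []) succ⇓

  addR : Rec 2
  addR = prec (proj zero) (comp succ (proj (suc zero) ∷ []))

  addR⇓ : ∀ m {n} → addR · (m ∷ n ∷ []) ⇓ m + n
  addR⇓ zero    = prec⇓-zero proj⇓
  addR⇓ (suc m) = prec⇓-suc (addR⇓ m) (comp⇓ (proj⇓ ∷ []) succ⇓)

  predR : Rec 1
  predR = prec zero (proj zero)

  predR⇓ : ∀ n → predR · (n ∷ []) ⇓ pred n
  predR⇓ zero    = prec⇓-zero zero⇓
  predR⇓ (suc n) = prec⇓-suc (predR⇓ n) proj⇓

  -- The subtrahend is the first argument.
  subR : Rec 2
  subR = prec (proj zero) (comp predR (proj (suc zero) ∷ []))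

  subR⇓ : ∀ n {m} → subR · (n ∷ m ∷ []) ⇓ m ∸ n
  subR⇓ zero        = prec⇓-zero proj⇓
  subR⇓ (suc n) {m} = ⇓-value (pred[m∸n]≡m∸[1+n] m n)
                        (prec⇓-suc (subR⇓ n) (comp⇓ (proj⇓ ∷ []) (predR⇓ (m ∸ n))))

  scaleR : ∀ {n} → ℕ → Rec n → Rec n
  scaleR zero    r = constR 0
  scaleR (suc k) r = comp addR (r ∷ scaleR k r ∷ [])

  scaleR⇓ : ∀ {n} k {r : Rec n} {xs y} → r · xs ⇓ y → scaleR k r · xs ⇓ k * y
  scaleR⇓ zero    p = constR⇓ 0
  scaleR⇓ (suc k) p = comp⇓ (p ∷ scaleR⇓ k p ∷ []) (addR⇓ _)

  pow2R : Rec 1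
  pow2R = prec (constR 1) (scaleR 2 (proj (suc zero)))

  pow2R⇓ : ∀ n → pow2R · (n ∷ []) ⇓ 2 ^ n
  pow2R⇓ zero    = prec⇓-zero (constR⇓ 1)
  pow2R⇓ (suc n) = prec⇓-suc (pow2R⇓ n) (scaleR⇓ 2 proj⇓)

  odd : ℕ → ℕ
  odd zero    = 0
  odd (suc n) = 1 ∸ odd n

  oddR : Rec 1
  oddR = prec zero (comp subR (proj (suc zero) ∷ constR 1 ∷ []))

  oddR⇓ : ∀ n → oddR · (n ∷ []) ⇓ odd n
  oddR⇓ zero    = prec⇓-zero zero⇓
  oddR⇓ (suc n) = prec⇓-suc (oddR⇓ n) (comp⇓ (proj⇓ ∷ constR⇓ 1 ∷ []) (subR⇓ (odd n)))

  half : ℕ → ℕ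
  half zero    = 0
  half (suc n) = half n + odd n

  halfR : Rec 1
  halfR = prec zero (comp addR (proj (suc zero) ∷ comp oddR (proj zero ∷ []) ∷ []))

  halfR⇓ : ∀ n → halfR · (n ∷ []) ⇓ half n
  halfR⇓ zero    = prec⇓-zero zero⇓
  halfR⇓ (suc n) = prec⇓-suc (halfR⇓ n)
    (comp⇓ (proj⇓ ∷ comp⇓ (proj⇓ ∷ []) (oddR⇓ n) ∷ []) (addR⇓ (half n)))

  odd-double : ∀ n → odd (2 * n) ≡ 0
  odd-double zero    = refl
  odd-double (suc n) rewrite +-suc n (n + 0) | odd-double n = refl

  half-double : ∀ n → half (2 * n) ≡ n
  half-double zero    = refl
  half-double (suc n) rewrite +-suc n (n + 0) | odd-double n | half-double n | +-identityʳ n = +-comm n 1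

  -- On codes, halving after subtracting one removes the first bit.
  dropR : Rec 2
  dropR = prec (proj zero) (comp halfR (comp predR (proj (suc zero) ∷ []) ∷ []))

  tail : String → String
  tail = drop 1

  half-pred-code : ∀ σ → half (pred (code σ)) ≡ code (tail σ)
  half-pred-code []          = refl
  half-pred-code (false ∷ σ) = half-double (code σ)
  half-pred-code (true ∷ σ)  rewrite odd-double (code σ) = trans (+-identityʳ _) (half-double (code σ))

  tail-drop : ∀ n σ → tail (drop n σ) ≡ drop (suc n) σ
  tail-drop zero    σ       = refl
  tail-drop (suc n) []      = refl
  tail-drop (suc n) (_ ∷ σ) = tail-drop n σ

  dropR⇓ : ∀ n σ → dropR · (n ∷ code σ ∷ []) ⇓ code (drop n σ)
  dropR⇓ zero    σ = prec⇓-zero proj⇓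
  dropR⇓ (suc n) σ = ⇓-value
    (trans (half-pred-code (drop n σ)) (cong code (tail-drop n σ)))
    (prec⇓-suc (dropR⇓ n σ) (comp⇓ (comp⇓ (proj⇓ ∷ []) (predR⇓ c) ∷ []) (halfR⇓ (pred c))))
    where c = code (drop n σ)

  -- The machine maps 0ʷ1ρ with |ρ| = P(w+1) to ρ0ʲ of length Q(w+1).  The
  -- header determines the length of ρ, hence the domain is prefix-free.
  module Padding (P Q : ℕ) where

    -- A code is odd if the string begins with `false`, and even if it begins with `true` or is
    -- empty; so the search counts the leading zeros.
    headerR : Rec 1
    headerR = mu (comp oddR (dropR ∷ []))

    -- The arguments are w and the code of the program.
    blocksR restR excessR paddedR : Rec 2
    blocksR = comp succ (proj zero ∷ [])
    restR   = comp dropR (blocksR ∷ proj (suc zero) ∷ [])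
    excessR = comp addR
      ( comp subR (comp succ (restR ∷ []) ∷ comp pow2R (scaleR P blocksR ∷ []) ∷ [])
      ∷ comp subR (comp pow2R (comp succ (scaleR P blocksR ∷ []) ∷ []) ∷
                   comp succ (comp succ (restR ∷ []) ∷ []) ∷ [])
      ∷ [])
    paddedR = comp addR
      ( restR
      ∷ comp subR (comp pow2R (scaleR P blocksR ∷ []) ∷ comp pow2R (scaleR Q blocksR ∷ []) ∷ [])
      ∷ [])

    -- Both truncated differences vanish exactly if 2^L ≤ r + 1 < 2^(L+1), where L = P(w+1), that
    -- is, if the string with code r has length L.
    excess : ℕ → ℕ → ℕ
    excess w r = (2 ^ (P * suc w) ∸ suc r) + (2 + r ∸ 2 ^ suc (P * suc w))

    padded : ℕ → ℕ → ℕ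
    padded w r = r + (2 ^ (Q * suc w) ∸ 2 ^ (P * suc w))

    -- Defined at 0 only.
    zeroOnlyR : Rec 1
    zeroOnlyR = mu (proj (suc zero))

    -- The summand from `zeroOnlyR` is 0 when it is defined; it makes the machine diverge unless the
    -- rest of the program has the right length.
    paddingR : Machine
    paddingR = comp (comp addR (comp zeroOnlyR (excessR ∷ []) ∷ paddedR ∷ [])) (headerR ∷ proj zero ∷ [])

    module _ (w : ℕ) (σ : String) where

      private
        x = code σ
        r = code (drop (suc w) σ)

      blocksR⇓ : blocksR · (w ∷ x ∷ []) ⇓ suc w
      blocksR⇓ = comp⇓ (proj⇓ ∷ []) succ⇓

      restR⇓ : restR · (w ∷ x ∷ []) ⇓ r
      restR⇓ = comp⇓ (blocksR⇓ ∷ proj⇓ ∷ []) (dropR⇓ (suc w) σ)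

      excessR⇓ : excessR · (w ∷ x ∷ []) ⇓ excess w r
      excessR⇓ = comp⇓
        ( comp⇓ (comp⇓ (restR⇓ ∷ []) succ⇓ ∷ comp⇓ (scaleR⇓ P blocksR⇓ ∷ []) (pow2R⇓ _) ∷ []) (subR⇓ _)
        ∷ comp⇓ (comp⇓ (comp⇓ (scaleR⇓ P blocksR⇓ ∷ []) succ⇓ ∷ []) (pow2R⇓ _) ∷
                 comp⇓ (comp⇓ (restR⇓ ∷ []) succ⇓ ∷ []) succ⇓ ∷ []) (subR⇓ _)
        ∷ []) (addR⇓ _)

      paddedR⇓ : paddedR · (w ∷ x ∷ []) ⇓ padded w r
      paddedR⇓ = comp⇓
        ( restR⇓
        ∷ comp⇓ (comp⇓ (scaleR⇓ P blocksR⇓ ∷ []) (pow2R⇓ _) ∷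
                 comp⇓ (scaleR⇓ Q blocksR⇓ ∷ []) (pow2R⇓ _) ∷ []) (subR⇓ _)
        ∷ []) (addR⇓ r)

    oddR-drop⇓ : ∀ w σ → comp oddR (dropR ∷ []) · (w ∷ code σ ∷ []) ⇓ odd (code (drop w σ))
    oddR-drop⇓ w σ = comp⇓ (dropR⇓ w σ ∷ []) (oddR⇓ _)

    program : ℕ → String → String
    program w ρ = replicate w false ++ true ∷ ρ

    odd-false : ∀ σ → odd (code (false ∷ σ)) ≡ 1
    odd-false σ rewrite odd-double (code σ) = refl

    odd-true : ∀ σ → odd (code (true ∷ σ)) ≡ 0
    odd-true σ rewrite odd-double (code σ) = refl

    odd-program : ∀ w ρ j → j < w → odd (code (drop j (program w ρ))) ≡ 1
    odd-program (suc w) ρ zero    _         = odd-false (program w ρ)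
    odd-program (suc w) ρ (suc j) (s≤s j<w) = odd-program w ρ j j<w

    drop-program : ∀ w ρ → drop w (program w ρ) ≡ true ∷ ρ
    drop-program zero    ρ = refl
    drop-program (suc w) ρ = drop-program w ρ

    headerR-program⇓ : ∀ w ρ → headerR · (code (program w ρ) ∷ []) ⇓ w
    headerR-program⇓ w ρ = mu⇓
      (λ j j<w → 0 , ⇓-value (odd-program w ρ j j<w) (oddR-drop⇓ j (program w ρ)))
      (⇓-value (trans (cong (λ σ → odd (code σ)) (drop-program w ρ)) (odd-true ρ))
        (oddR-drop⇓ w (program w ρ)))

    ⟨program⟩↓ : P ≤ Q → ∀ w ρ → length ρ ≡ P * suc w →
                 paddingR ⟨ program w ρ ⟩↓ ρ ++ replicate ((Q ∸ P) * suc w) false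
    ⟨program⟩↓ P≤Q w ρ eq = ⇓-value value
      (comp⇓ (headerR-program⇓ w ρ ∷ proj⇓ ∷ [])
        (comp⇓ (comp⇓ (excessR⇓ w (program w ρ) ∷ []) (mu⇓ (λ _ ()) (⇓-value excess≡0 proj⇓)) ∷ paddedR⇓ w (program w ρ) ∷ [])
               (addR⇓ 0)))
      where
      rest≡ : drop (suc w) (program w ρ) ≡ ρ
      rest≡ = trans (sym (tail-drop w (program w ρ))) (cong tail (drop-program w ρ))
      excess≡0 : excess w (code (drop (suc w) (program w ρ))) ≡ 0
      excess≡0 rewrite rest≡ | sym eq =
        cong₂ _+_ (m≤n⇒m∸n≡0 (2^length≤ ρ)) (m≤n⇒m∸n≡0 (suc[code]<2^ ρ))
      split : P * suc w + (Q ∸ P) * suc w ≡ Q * suc w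
      split = trans (sym (*-distribʳ-+ (suc w) P (Q ∸ P))) (cong (_* suc w) (m+[n∸m]≡n P≤Q))
      value : padded w (code (drop (suc w) (program w ρ))) ≡ code (ρ ++ replicate ((Q ∸ P) * suc w) false)
      value rewrite rest≡ = +-cancelʳ-≡ (2 ^ (P * suc w)) _ _ (begin
        code ρ + (2 ^ (Q * suc w) ∸ 2 ^ (P * suc w)) + 2 ^ (P * suc w)
          ≡⟨ +-assoc (code ρ) _ _ ⟩
        code ρ + (2 ^ (Q * suc w) ∸ 2 ^ (P * suc w) + 2 ^ (P * suc w))
          ≡⟨ cong (code ρ +_) (m∸n+n≡m (^-monoʳ-≤ 2 (*-monoˡ-≤ (suc w) P≤Q))) ⟩
        code ρ + 2 ^ (Q * suc w)
          ≡⟨ cong (λ n → code ρ + 2 ^ n) (trans (sym split) (cong (_+ (Q ∸ P) * suc w) (sym eq))) ⟩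
        code ρ + 2 ^ (length ρ + (Q ∸ P) * suc w)
          ≡⟨ code-pad ρ ((Q ∸ P) * suc w) ⟨
        code (ρ ++ replicate ((Q ∸ P) * suc w) false) + 2 ^ length ρ
          ≡⟨ cong (λ n → code (ρ ++ replicate ((Q ∸ P) * suc w) false) + 2 ^ n) eq ⟩
        code (ρ ++ replicate ((Q ∸ P) * suc w) false) + 2 ^ (P * suc w) ∎)
        where open ≡-Reasoning

    length-program : ∀ w ρ → length ρ ≡ P * suc w → length (program w ρ) ≡ suc P * suc w
    length-program w ρ eq = begin
      length (replicate w false ++ true ∷ ρ)        ≡⟨ length-++ (replicate w false) ⟩
      length (replicate w false) + suc (length ρ)   ≡⟨ cong₂ (λ m n → m + suc n) (length-replicate w) eq ⟩
      w + suc (P * suc w)                           ≡⟨ +-suc w (P * suc w) ⟩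
      suc P * suc w                                 ∎
      where open ≡-Reasoning

    excess≡0⇒length : ∀ w ρ → excess w (code ρ) ≡ 0 → length ρ ≡ P * suc w
    excess≡0⇒length w ρ eq with <-cmp (length ρ) (P * suc w)
    ... | tri≈ _ l≡ _ = l≡
    ... | tri< l< _ _ = contradiction
      (≤-trans (≤-trans (suc[code]<2^ ρ) (^-monoʳ-≤ 2 l<)) (m∸n≡0⇒m≤n (m+n≡0⇒m≡0 _ eq))) (<-irrefl refl)
    ... | tri> _ _ l> = contradiction
      (≤-trans (m∸n≡0⇒m≤n (m+n≡0⇒n≡0 (2 ^ (P * suc w) ∸ suc (code ρ)) eq))
               (≤-trans (^-monoʳ-≤ 2 l>) (2^length≤ ρ))) (<-irrefl refl)

    -- The search for the header also stops at the end of a string of zeros, as `code []` is even.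
    -- Such a program has an empty rest, which the length test rejects since `P` is positive.
    domain : 1 ≤ P → ∀ τ σ → paddingR ⟨ τ ⟩↓ σ → ∃[ w ] ∃[ ρ ] (τ ≡ program w ρ × length ρ ≡ P * suc w)
    domain 1≤P τ σ (comp⇓ (mu⇓ {k = w} before at ∷ proj⇓ ∷ []) (comp⇓ (comp⇓ (p ∷ []) (mu⇓ _ q) ∷ _) _)) =
      w , drop (suc w) τ , shape w τ ones zero-at (λ eq → rest≢[] (cong length eq)) , rest-length
      where
      ones : ∀ j → j < w → ∃[ v ] odd (code (drop j τ)) ≡ suc v
      ones j j<w = proj₁ (before j j<w) , ⇓-deterministic _ (oddR-drop⇓ j τ) (proj₂ (before j j<w))
      zero-at : odd (code (drop w τ)) ≡ 0
      zero-at = ⇓-deterministic _ (oddR-drop⇓ w τ) at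
      rest-length : length (drop (suc w) τ) ≡ P * suc w
      rest-length = excess≡0⇒length w (drop (suc w) τ)
        (trans (⇓-deterministic _ (excessR⇓ w τ) p) (⇓-deterministic _ proj⇓ q))
      rest≢[] : length (drop (suc w) τ) ≢ 0
      rest≢[] eq = contradiction (trans (sym rest-length) eq) (m<n⇒n≢0 (*-mono-≤ 1≤P (s≤s (z≤n {w}))))
      shape : ∀ w τ → (∀ j → j < w → ∃[ v ] odd (code (drop j τ)) ≡ suc v) →
              odd (code (drop w τ)) ≡ 0 → drop (suc w) τ ≢ [] → τ ≡ program w (drop (suc w) τ)
      shape zero    []          _    _  ne = contradiction refl ne
      shape zero    (true ∷ τ)  _    _  _  = refl
      shape zero    (false ∷ τ) _    eq _  = contradiction (trans (sym eq) (odd-false τ)) 0≢1+n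
      shape (suc w) []          _    _  ne = contradiction refl ne
      shape (suc w) (false ∷ τ) ones eq ne =
        cong (false ∷_) (shape w τ (λ j j<w → ones (suc j) (s≤s j<w)) eq ne)
      shape (suc w) (true ∷ τ)  ones _  _  =
        contradiction (trans (sym (odd-true τ)) (proj₂ (ones 0 (s≤s z≤n)))) 0≢1+n

    prefix-of-same-length : ∀ {ρ ρ′ : String} → Prefix _≡_ ρ ρ′ → length ρ ≡ length ρ′ → ρ ≡ ρ′
    prefix-of-same-length {ρ′ = []}    []         _  = refl
    prefix-of-same-length {ρ′ = _ ∷ _} []         ()
    prefix-of-same-length              (refl ∷ p) eq = cong (_ ∷_) (prefix-of-same-length p (suc-injective eq))

    program-prefix : ∀ w w′ ρ ρ′ → Prefix _≡_ (program w ρ) (program w′ ρ′) → w ≡ w′ × Prefix _≡_ ρ ρ′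
    program-prefix zero    zero     _ _ (_ ∷ p)  = refl , p
    program-prefix zero    (suc w′) _ _ (() ∷ _)
    program-prefix (suc w) zero     _ _ (() ∷ _)
    program-prefix (suc w) (suc w′) _ _ (_ ∷ p)  with refl , q ← program-prefix w w′ _ _ p = refl , q

    paddingR-prefixFree : 1 ≤ P → PrefixFree paddingR
    paddingR-prefixFree 1≤P τ τ′ σ σ′ p p′ τ⊑τ′
      with (w , ρ , refl , eq) ← domain 1≤P τ σ p
         | (w′ , ρ′ , refl , eq′) ← domain 1≤P τ′ σ′ p′
      with refl , ρ⊑ρ′ ← program-prefix w w′ ρ ρ′ τ⊑τ′
      = cong (program w) (prefix-of-same-length ρ⊑ρ′ (trans eq (sym eq′)))

-- Choice of the free positions, block by block.

module FreePositions where

  open import Data.Nat.Base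
  open import Data.Nat.Properties
  open import Relation.Nullary.Decidable using (dec-true; dec-false)
  open ≡

  bump : Bool → ℕ → ℕ
  bump true  = suc
  bump false n = n

  count : (ℕ → Bool) → ℕ → ℕ
  count F zero    = 0
  count F (suc n) = bump (F 0) (count (F ∘ suc) n)

  bump-comm : ∀ a b n → bump a (bump b n) ≡ bump b (bump a n)
  bump-comm true  true  n = refl
  bump-comm true  false n = refl
  bump-comm false b     n = refl

  count-suc : ∀ F n → count F (suc n) ≡ bump (F n) (count F n)
  count-suc F zero    = refl
  count-suc F (suc n) = trans (cong (bump (F 0)) (count-suc (F ∘ suc) n))
                              (bump-comm (F 0) (F (suc n)) (count (F ∘ suc) n))

  -- The positions are divided into blocks [o , e), each of which begins with
  -- free positions [o , m) followed by non-free positions [m , e).  Ok n b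
  -- says that b free positions among the first n are enough.
  module Blocks
    (Ok : ℕ → ℕ → Set) (Thin : ℕ → ℕ → ℕ → Set)
    (start : Ok 0 0)
    (free-step : ∀ {n b} → Ok n b → Ok (suc n) (suc b))
    (antitone : ∀ {m n b} → m ≤ n → Ok n b → Ok m b)
    (choose : ∀ n b → Ok n b → ∃[ m ] ∃[ e ] (n ≤ m × m ≤ e × n < e × Ok e (b + (m ∸ n)) × Thin n m e))
    where

    record Block : Set where
      field
        o m e : ℕ
        o≤m   : o ≤ m
        m≤e   : m ≤ e
        thin  : Thin o m e

    open Block

    -- The invariant `target` says that the count with which the block will end is enough at its
    -- end. Once the free positions of the block are spent, this count has been reached, and
    -- `antitone` carries `Ok` back to the remaining positions.
    record State (n : ℕ) : Set where
      field
        block  : Block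
        b      : ℕ
        o≤n    : o block ≤ n
        n<e    : n < e block
        ok     : Ok n b
        target : Ok (e block) (b + (m block ∸ n))

    open State

    enter : ∀ n b → Ok n b → State n
    enter n b ok with (m , e , n≤m , m≤e , n<e , target , thin) ← choose n b ok = record
      { block  = record { o = n ; m = m ; e = e ; o≤m = n≤m ; m≤e = m≤e ; thin = thin }
      ; b      = b
      ; o≤n    = ≤-refl
      ; n<e    = n<e
      ; ok     = ok
      ; target = target
      }

    enter-o : ∀ n b ok → o (block (enter n b ok)) ≡ n
    enter-o n b ok with (_ , _ , _ , _ , _ , _ , _) ← choose n b ok = refl

    enter-b : ∀ n x ok → b (enter n x ok) ≡ x
    enter-b n x ok with (_ , _ , _ , _ , _ , _ , _) ← choose n x ok = refl

    free : ∀ {n} → State n → Bool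
    free {n} s = does (n <? m (block s))

    target-suc : ∀ {n} (s : State n) → Ok (e (block s)) (bump (free s) (b s) + (m (block s) ∸ suc n))
    target-suc {n} s with n <? m (block s)
    ... | yes n<m rewrite dec-true (n <? m (block s)) n<m = subst (Ok (e (block s)))
      (trans (cong (b s +_) (sym (trans (cong suc (sym (pred[m∸n]≡m∸[1+n] (m (block s)) n)))
                                       (suc-pred _ {{>-nonZero (m<n⇒0<n∸m n<m)}}))))
             (+-suc (b s) _)) (target s)
    ... | no n≮m rewrite dec-false (n <? m (block s)) n≮m = subst (λ k → Ok (e (block s)) (b s + k))
      (trans (m≤n⇒m∸n≡0 (≮⇒≥ n≮m)) (sym (m≤n⇒m∸n≡0 (m≤n⇒m≤1+n (≮⇒≥ n≮m))))) (target s)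

    ok-suc : ∀ {n} (s : State n) → Ok (suc n) (bump (free s) (b s))
    ok-suc {n} s with n <? m (block s)
    ... | yes n<m rewrite dec-true (n <? m (block s)) n<m = free-step (ok s)
    ... | no n≮m rewrite dec-false (n <? m (block s)) n≮m = antitone (n<e s)
      (subst (Ok (e (block s))) (trans (cong (b s +_) (m≤n⇒m∸n≡0 (≮⇒≥ n≮m))) (+-identityʳ (b s))) (target s))

    continue : ∀ {n} (s : State n) → suc n < e (block s) → State (suc n)
    continue s lt = record
      { block  = block s
      ; b      = bump (free s) (b s)
      ; o≤n    = m≤n⇒m≤1+n (o≤n s)
      ; n<e    = lt
      ; ok     = ok-suc s
      ; target = target-suc s
      }

    step : ∀ {n} → State n → State (suc n)
    step {n} s with suc n <? e (block s)
    ... | yes lt = continue s lt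
    ... | no _   = enter (suc n) _ (ok-suc s)

    step-b : ∀ {n} (s : State n) → b (step s) ≡ bump (free s) (b s)
    step-b {n} s with suc n <? e (block s)
    ... | yes _ = refl
    ... | no _  = enter-b (suc n) _ (ok-suc s)

    state : ∀ n → State n
    state zero    = enter 0 0 start
    state (suc n) = step (state n)

    F : ℕ → Bool
    F n = free (state n)

    b≡count : ∀ n → b (state n) ≡ count F n
    b≡count zero    = enter-b 0 0 start
    b≡count (suc n) = trans (step-b (state n))
      (trans (cong (bump (F n)) (b≡count n)) (sym (count-suc F n)))

    count-ok : ∀ n → Ok n (count F n)
    count-ok n = subst (Ok n) (b≡count n) (ok (state n))

    not-free : ∀ n i → m (block (state n)) ≤ i → i ≤ n → F i ≡ false
    not-free n i m≤i i≤n with m≤n⇒m<n∨m≡n i≤n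
    ... | inj₂ refl = dec-false (n <? m (block (state n))) (≤⇒≯ m≤i)
    not-free (suc n) i m≤i i≤n | inj₁ (s≤s i≤n′) = earlier m≤i
      where
      earlier : m (block (step (state n))) ≤ i → F i ≡ false
      earlier m≤i with suc n <? e (block (state n))
      ... | yes _ = not-free n i m≤i i≤n′
      ... | no _  = contradiction
        (≤-trans (≤-reflexive (sym (enter-o (suc n) _ (ok-suc (state n)))))
          (≤-trans (o≤m (block (enter (suc n) _ (ok-suc (state n))))) m≤i))
        (≤⇒≯ i≤n′)

    -- Induction on a bound `k` for the distance to the end of the current block, which does not
    -- change on the way.
    block-end : ∀ k n → e (block (state n)) ≤ suc n + k →
                ∃[ n′ ] (n ≤ n′ × suc n′ ≡ e (block (state n′)) × block (state n′) ≡ block (state n))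
    block-end zero n e≤ =
      n , ≤-refl , ≤-antisym (n<e (state n)) (≤-trans e≤ (≤-reflexive (+-identityʳ (suc n)))) , refl
    block-end (suc k) n e≤ with suc n <? e (block (state n)) in eq
    ... | no e≮  = n , ≤-refl , ≤-antisym (n<e (state n)) (≮⇒≥ e≮) , refl
    ... | yes lt = n′ , ≤-trans (n≤1+n n) n≤n′ , at-end , trans same unchanged
      where
      unchanged : block (step (state n)) ≡ block (state n)
      unchanged rewrite eq = refl
      rec = block-end k (suc n)
        (subst (λ B → e B ≤ suc (suc n) + k) (sym unchanged) (≤-trans e≤ (≤-reflexive (+-suc (suc n) k))))
      n′     = proj₁ rec
      n≤n′   = proj₁ (proj₂ rec)
      at-end = proj₁ (proj₂ (proj₂ rec))
      same   = proj₂ (proj₂ (proj₂ rec))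

    thin-blocks : ∀ N → ∃[ o ] ∃[ m ] ∃[ e ] (N ≤ o × o ≤ e × m ≤ e × Thin o m e ×
                  (∀ i → m ≤ i → i < e → F i ≡ false))
    thin-blocks N = o B , m B , e B ,
      ≤-trans N≤n (≤-trans (n≤1+n n) (≤-reflexive (sym o≡))) , ≤-trans (o≤m B) (m≤e B) , m≤e B , thin B ,
      λ i m≤i i<e → not-free n′ i m≤i (≤-pred (≤-trans i<e (≤-reflexive (sym end′))))
      where
      -- The block that contains `N` may have begun before it. The following block begins after `N`,
      -- and at its last position the whole of its non-free part has been decided.
      first = block-end (e (block (state N))) N (m≤n+m _ (suc N))
      n     = proj₁ first
      N≤n   = proj₁ (proj₂ first)
      end   = proj₁ (proj₂ (proj₂ first))
      renewed : o (block (state (suc n))) ≡ suc n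
      renewed with suc n <? e (block (state n))
      ... | yes lt = contradiction end (<⇒≢ lt)
      ... | no _   = enter-o (suc n) _ (ok-suc (state n))
      second = block-end (e (block (state (suc n)))) (suc n) (m≤n+m _ (suc (suc n)))
      n′     = proj₁ second
      B      = block (state n′)
      end′   = proj₁ (proj₂ (proj₂ second))
      o≡ : o B ≡ suc n
      o≡ = trans (cong o (proj₂ (proj₂ (proj₂ second)))) renewed

-- Arithmetic in the ordered field and powers of 1/2.

module RealProperties (em : ExcludedMiddle 0ℓ) (𝓡 : CompleteOrderedField) where

  open CompleteOrderedField 𝓡 renaming (Carrier to ℝ)
  open IsTotalOrder isTotalOrder using (total; antisym; reflexive; isPartialOrder)
    renaming (refl to ≤-refl; trans to ≤-trans) public
  open CommutativeRing commutativeRing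
    using ( +-cong; +-congˡ; +-comm; +-assoc; +-identityˡ; +-identityʳ; -‿inverseˡ; -‿inverseʳ
          ; *-congˡ; *-congʳ; *-comm; *-assoc; *-identityˡ; *-identityʳ; distribˡ; distribʳ
          ; zeroˡ; zeroʳ; semiring; *-commutativeSemigroup; +-commutativeSemigroup)
    renaming (refl to ≈-refl; sym to ≈-sym; trans to ≈-trans; reflexive to ≡⇒≈) public
  open Exp semiring using (^-homo-*; ^-assocʳ) public
  open Mult semiring using (×-homo-+; ×1-homo-*) public
  module *-Properties = CommutativeSemigroupProperties *-commutativeSemigroup
  module +-Properties = CommutativeSemigroupProperties +-commutativeSemigroup

  poset : Poset _ _ _
  poset = record { isPartialOrder = isPartialOrder }

  module ≤-Reasoning = PartialOrderReasoning poset
  open ≤-Reasoning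

  <⇒≤ : ∀ {x y} → x < y → x ≤ y
  <⇒≤ = proj₁

  <⇒≱ : ∀ {x y} → x < y → ¬ y ≤ x
  <⇒≱ (x≤y , x≉y) y≤x = x≉y (antisym x≤y y≤x)

  ≰⇒> : ∀ {x y} → ¬ x ≤ y → y < x
  ≰⇒> {x} {y} x≰y with total x y
  ... | inj₁ x≤y = contradiction x≤y x≰y
  ... | inj₂ y≤x = y≤x , λ y≈x → x≰y (reflexive (≈-sym y≈x))

  <-≤-trans : ∀ {x y z} → x < y → y ≤ z → x < z
  <-≤-trans x<y y≤z = ≤-trans (<⇒≤ x<y) y≤z , λ x≈z → <⇒≱ x<y (≤-trans y≤z (reflexive (≈-sym x≈z)))

  ≤-<-trans : ∀ {x y z} → x ≤ y → y < z → x < z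
  ≤-<-trans x≤y y<z = ≤-trans x≤y (<⇒≤ y<z) , λ x≈z → <⇒≱ y<z (≤-trans (reflexive (≈-sym x≈z)) x≤y)

  +-monoʳ-≤ : ∀ z {x y} → x ≤ y → z + x ≤ z + y
  +-monoʳ-≤ z {x} {y} x≤y = begin
    z + x ≈⟨ +-comm z x ⟩
    x + z ≤⟨ +-monoˡ-≤ z x≤y ⟩
    y + z ≈⟨ +-comm y z ⟩
    z + y ∎

  +-mono-≤ : ∀ {w x y z} → w ≤ x → y ≤ z → w + y ≤ x + z
  +-mono-≤ {w} {x} {y} {z} w≤x y≤z = ≤-trans (+-monoˡ-≤ y w≤x) (+-monoʳ-≤ x y≤z)

  +-cancelʳ-≤ : ∀ z {x y} → x + z ≤ y + z → x ≤ y
  +-cancelʳ-≤ z {x} {y} le = begin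
    x             ≈⟨ undo x ⟨
    x + z + - z   ≤⟨ +-monoˡ-≤ (- z) le ⟩
    y + z + - z   ≈⟨ undo y ⟩
    y             ∎
    where
    undo : ∀ w → w + z + - z ≈ w
    undo w = ≈-trans (+-assoc w z (- z)) (≈-trans (+-congˡ (-‿inverseʳ z)) (+-identityʳ w))

  0≤x+y : ∀ {x y} → 0# ≤ x → 0# ≤ y → 0# ≤ x + y
  0≤x+y 0≤x 0≤y = ≤-trans (reflexive (≈-sym (+-identityˡ 0#))) (+-mono-≤ 0≤x 0≤y)

  x≤x+y : ∀ {x y} → 0# ≤ y → x ≤ x + y
  x≤x+y {x} 0≤y = ≤-trans (reflexive (≈-sym (+-identityʳ x))) (+-monoʳ-≤ x 0≤y)

  *-monoˡ-≤ : ∀ {z x y} → 0# ≤ z → x ≤ y → z * x ≤ z * y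
  *-monoˡ-≤ {z} {x} {y} 0≤z x≤y = +-cancelʳ-≤ (z * - x) (begin
    z * x + z * - x  ≈⟨ distribˡ z x (- x) ⟨
    z * (x + - x)    ≈⟨ *-congˡ (-‿inverseʳ x) ⟩
    z * 0#           ≈⟨ zeroʳ z ⟩
    0#               ≤⟨ *-nonNegative 0≤z 0≤y-x ⟩
    z * (y + - x)    ≈⟨ distribˡ z y (- x) ⟩
    z * y + z * - x  ∎)
    where
    0≤y-x : 0# ≤ y + - x
    0≤y-x = ≤-trans (reflexive (≈-sym (-‿inverseʳ x))) (+-monoˡ-≤ (- x) x≤y)

  *-monoʳ-≤ : ∀ {z x y} → 0# ≤ z → x ≤ y → x * z ≤ y * z
  *-monoʳ-≤ {z} {x} {y} 0≤z x≤y = begin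
    x * z ≈⟨ *-comm x z ⟩
    z * x ≤⟨ *-monoˡ-≤ 0≤z x≤y ⟩
    z * y ≈⟨ *-comm z y ⟩
    y * z ∎

  *-mono-≤ : ∀ {w x y z} → 0# ≤ w → 0# ≤ z → w ≤ x → y ≤ z → w * y ≤ x * z
  *-mono-≤ 0≤w 0≤z w≤x y≤z = ≤-trans (*-monoˡ-≤ 0≤w y≤z) (*-monoʳ-≤ 0≤z w≤x)

  *-cancelʳ-≤ : ∀ {z x y} → 0# < z → x * z ≤ y * z → x ≤ y
  *-cancelʳ-≤ {z} {x} {y} 0<z le = begin
    x              ≈⟨ undo x ⟨
    x * z * z ⁻¹   ≤⟨ *-monoʳ-≤ (⁻¹-nonNegative (<⇒≤ 0<z) z≉0) le ⟩
    y * z * z ⁻¹   ≈⟨ undo y ⟩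
    y              ∎
    where
    z≉0 : ¬ z ≈ 0#
    z≉0 z≈0 = proj₂ 0<z (≈-sym z≈0)
    undo : ∀ w → w * z * z ⁻¹ ≈ w
    undo w = ≈-trans (*-assoc w z (z ⁻¹)) (≈-trans (*-congˡ (⁻¹-inverseʳ z≉0)) (*-identityʳ w))

  *-cancelˡ-≤ : ∀ {z x y} → 0# < z → z * x ≤ z * y → x ≤ y
  *-cancelˡ-≤ {z} {x} {y} 0<z le =
    *-cancelʳ-≤ 0<z (≤-trans (reflexive (*-comm x z)) (≤-trans le (reflexive (*-comm z y))))

  0<1 : 0# < 1#
  0<1 = 0≤1 , 0≉1

  0<x*y : ∀ {x y} → 0# < x → 0# < y → 0# < x * y
  0<x*y {x} {y} 0<x 0<y = ≰⇒> λ xy≤0 →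
    <⇒≱ 0<y (*-cancelˡ-≤ 0<x (≤-trans xy≤0 (reflexive (≈-sym (zeroʳ x)))))

  fromℕ-+ : ∀ m n → fromℕ (m ℕ.+ n) ≈ fromℕ m + fromℕ n
  fromℕ-+ = ×-homo-+ 1#

  fromℕ-* : ∀ m n → fromℕ (m ℕ.* n) ≈ fromℕ m * fromℕ n
  fromℕ-* = ×1-homo-*

  fromℕ-mono : ∀ {m n} → m ℕ.≤ n → fromℕ m ≤ fromℕ n
  fromℕ-mono {n = n} z≤n = fromℕ-nonNegative n
  fromℕ-mono (s≤s m≤n)   = +-monoʳ-≤ 1# (fromℕ-mono m≤n)

  0<fromℕ : ∀ n → 0# < fromℕ (suc n)
  0<fromℕ n = fromℕ-nonNegative (suc n) , λ eq → fromℕ-nonZero n (≈-sym eq)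

  fromℕ-cancel-≤ : ∀ {m n} → fromℕ m ≤ fromℕ n → m ℕ.≤ n
  fromℕ-cancel-≤ {zero}          _  = z≤n
  fromℕ-cancel-≤ {suc m} {zero}  le = contradiction le (<⇒≱ (0<fromℕ m))
  fromℕ-cancel-≤ {suc m} {suc n} le = s≤s (fromℕ-cancel-≤ (+-cancelʳ-≤ 1# (begin
    fromℕ m + 1# ≈⟨ +-comm _ 1# ⟩
    fromℕ (suc m) ≤⟨ le ⟩
    fromℕ (suc n) ≈⟨ +-comm 1# _ ⟩
    fromℕ n + 1# ∎)))

  fromℕ-< : ∀ n → fromℕ n < fromℕ (suc n)
  fromℕ-< n = fromℕ-mono (ℕ.n≤1+n n) , λ eq →
    ℕ.<-irrefl ≡.refl (fromℕ-cancel-≤ {suc n} {n} (reflexive (≈-sym eq)))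

  -- If the natural numbers were bounded, their supremum minus one would be an upper bound too.
  archimedean : ∀ x → ∃[ n ] x ≤ fromℕ n
  archimedean x with em {∃[ n ] x ≤ fromℕ n}
  ... | yes found = found
  ... | no none
    with (l , upper , least) ← complete (λ y → ∃[ n ] y ≈ fromℕ n) (0# , 0 , ≈-refl)
           (x , λ y (n , y≈n) → ≤-trans (reflexive y≈n) (<⇒≤ (≰⇒> λ x≤n → none (n , x≤n))))
    = contradiction (+-cancelʳ-≤ l (begin
        1# + l         ≤⟨ +-monoʳ-≤ 1# (least (l + - 1#) (λ y (n , y≈n) → +-cancelʳ-≤ 1# (begin
                            y + 1#           ≈⟨ +-comm y 1# ⟩
                            1# + y           ≤⟨ upper (1# + y) (suc n , +-congˡ y≈n) ⟩
                            l                ≈⟨ shift l ⟨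
                            l + - 1# + 1#    ∎))) ⟩
        1# + (l + - 1#) ≈⟨ +-comm 1# _ ⟩
        l + - 1# + 1#   ≈⟨ shift l ⟩
        l               ≈⟨ +-identityˡ l ⟨
        0# + l          ∎)) (<⇒≱ 0<1)
    where
    shift : ∀ y → y + - 1# + 1# ≈ y
    shift y = ≈-trans (+-assoc y _ _) (≈-trans (+-congˡ (-‿inverseˡ 1#)) (+-identityʳ y))

  -- The first inequality is strict because p/q has to exceed `s` even when `s` is itself a fraction
  -- with denominator q.
  next-integer : ∀ {x} → 0# ≤ x → ∃[ p ] (x < fromℕ p × fromℕ p ≤ x + 1#)
  next-integer {x} 0≤x with (n , x≤n) ← archimedean x =
    descend (suc n) (≤-<-trans x≤n (fromℕ-< n))
    where
    descend : ∀ p → x < fromℕ p → ∃[ p ] (x < fromℕ p × fromℕ p ≤ x + 1#)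
    descend zero    x<p = contradiction 0≤x (<⇒≱ x<p)
    descend (suc p) x<1+p with em {x < fromℕ p}
    ... | yes x<p = descend p x<p
    ... | no x≮p  = suc p , x<1+p , (begin
      1# + fromℕ p ≤⟨ +-monoʳ-≤ 1# p≤x ⟩
      1# + x       ≈⟨ +-comm 1# x ⟩
      x + 1#       ∎)
      where
      p≤x : fromℕ p ≤ x
      p≤x with em {fromℕ p ≤ x}
      ... | yes le = le
      ... | no nle = contradiction (≰⇒> nle) x≮p

  ^-mono-≤ : ∀ {x y} → 0# ≤ x → x ≤ y → ∀ n → x ^ n ≤ y ^ n
  ^-mono-≤ 0≤x x≤y zero    = ≤-refl
  ^-mono-≤ 0≤x x≤y (suc n) =
    *-mono-≤ 0≤x (^-nonNegative (≤-trans 0≤x x≤y) n) x≤y (^-mono-≤ 0≤x x≤y n)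

  0<x^n : ∀ {x} → 0# < x → ∀ n → 0# < x ^ n
  0<x^n 0<x zero    = 0<1
  0<x^n 0<x (suc n) = 0<x*y 0<x (0<x^n 0<x n)

  ^-cancel-≤ : ∀ {x y} n → 0# ≤ y → x ^ suc n ≤ y ^ suc n → x ≤ y
  ^-cancel-≤ {x} {y} n 0≤y le with em {x ≤ y}
  ... | yes x≤y = x≤y
  ... | no x≰y  = *-cancelʳ-≤ (0<x^n (≤-<-trans 0≤y y<x) n)
                    (≤-trans le (*-monoˡ-≤ 0≤y (^-mono-≤ 0≤y (<⇒≤ y<x) n)))
    where y<x = ≰⇒> x≰y

  ^-anti-≤ : ∀ {x} → 0# ≤ x → x ≤ 1# → ∀ {m n} → m ℕ.≤ n → x ^ n ≤ x ^ m
  ^-anti-≤ 0≤x x≤1 {n = zero}  z≤n = ≤-refl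
  ^-anti-≤ 0≤x x≤1 {n = suc n} z≤n = ≤-trans
    (*-mono-≤ 0≤x 0≤1 x≤1 (^-anti-≤ 0≤x x≤1 {n = n} z≤n)) (reflexive (*-identityˡ 1#))
  ^-anti-≤ 0≤x x≤1 (s≤s m≤n) = *-monoˡ-≤ 0≤x (^-anti-≤ 0≤x x≤1 m≤n)

  /-* : ∀ y n → y / suc n * fromℕ (suc n) ≈ y
  /-* y n = ≈-trans (*-assoc y _ _)
    (≈-trans (*-congˡ (≈-trans (*-comm _ _) (⁻¹-inverseʳ (fromℕ-nonZero n)))) (*-identityʳ y))

  ≤-/ : ∀ {x y} n → x * fromℕ (suc n) ≤ y → x ≤ y / suc n
  ≤-/ {y = y} n le = *-cancelʳ-≤ (0<fromℕ n) (≤-trans le (reflexive (≈-sym (/-* y n))))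

  ≤-/⁻¹ : ∀ {x y} n → x ≤ y / suc n → x * fromℕ (suc n) ≤ y
  ≤-/⁻¹ {y = y} n le = ≤-trans (*-monoʳ-≤ (fromℕ-nonNegative (suc n)) le) (reflexive (/-* y n))

  /-≤⁻¹ : ∀ {x y} n → y / suc n ≤ x → y ≤ x * fromℕ (suc n)
  /-≤⁻¹ {y = y} n le = ≤-trans (reflexive (≈-sym (/-* y n))) (*-monoʳ-≤ (fromℕ-nonNegative (suc n)) le)

  h : ℝ
  h = fromℕ 2 ⁻¹

  h+h≈1 : h + h ≈ 1#
  h+h≈1 = begin-equality
    h + h             ≈⟨ +-cong (*-identityˡ h) (*-identityˡ h) ⟨
    1# * h + 1# * h   ≈⟨ distribʳ h 1# 1# ⟨
    (1# + 1#) * h     ≈⟨ *-congʳ (+-congˡ (+-identityʳ 1#)) ⟨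
    fromℕ 2 * h       ≈⟨ ⁻¹-inverseʳ (fromℕ-nonZero 1) ⟩
    1#                ∎

  0≤h : 0# ≤ h
  0≤h = ⁻¹-nonNegative (fromℕ-nonNegative 2) (fromℕ-nonZero 1)

  0<h : 0# < h
  0<h = 0≤h , λ 0≈h → 0≉1 (≈-trans (≈-sym (+-identityˡ 0#)) (≈-trans (+-cong 0≈h 0≈h) h+h≈1))

  h≤1 : h ≤ 1#
  h≤1 = ≤-trans (x≤x+y 0≤h) (reflexive h+h≈1)

  0≤h^ : ∀ n → 0# ≤ h ^ n
  0≤h^ = ^-nonNegative 0≤h

  0<h^ : ∀ n → 0# < h ^ n
  0<h^ = 0<x^n 0<h

  h^-anti : ∀ {m n} → m ℕ.≤ n → h ^ n ≤ h ^ m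
  h^-anti = ^-anti-≤ 0≤h h≤1

  h^n≤1 : ∀ n → h ^ n ≤ 1#
  h^n≤1 n = h^-anti {0} {n} z≤n

  h*x+h*x≈x : ∀ x → h * x + h * x ≈ x
  h*x+h*x≈x x = ≈-trans (≈-sym (distribʳ x h h)) (≈-trans (*-congʳ h+h≈1) (*-identityˡ x))

  h*x<x : ∀ {x} → 0# < x → h * x < x
  h*x<x {x} 0<x = ≰⇒> λ x≤hx → <⇒≱ (0<x*y 0<h 0<x) (+-cancelʳ-≤ (h * x) (begin
    h * x + h * x  ≈⟨ h*x+h*x≈x x ⟩
    x              ≤⟨ x≤hx ⟩
    h * x          ≈⟨ +-identityˡ _ ⟨
    0# + h * x     ∎))

  n*h^n≤1 : ∀ n → fromℕ n * h ^ n ≤ 1#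
  n*h^n≤1 zero    = ≤-trans (reflexive (zeroˡ _)) 0≤1
  n*h^n≤1 (suc n) = begin
    (1# + fromℕ n) * (h * h ^ n)               ≈⟨ *-Properties.x∙yz≈y∙xz _ _ _ ⟩
    h * ((1# + fromℕ n) * h ^ n)               ≈⟨ *-congˡ (distribʳ _ _ _) ⟩
    h * (1# * h ^ n + fromℕ n * h ^ n)         ≤⟨ *-monoˡ-≤ 0≤h (+-mono-≤
                                                   (≤-trans (reflexive (*-identityˡ _)) (h^n≤1 n))
                                                   (n*h^n≤1 n)) ⟩
    h * (1# + 1#)                              ≈⟨ distribˡ _ _ _ ⟩
    h * 1# + h * 1#                            ≈⟨ h*x+h*x≈x 1# ⟩
    1#                                         ∎

  h^n≤ε : ∀ {ε} → 0# < ε → ∃[ n ] h ^ n ≤ ε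
  h^n≤ε {ε} 0<ε with (n , ε⁻¹≤n) ← archimedean (ε ⁻¹) = n , (begin
    h ^ n                   ≈⟨ *-identityʳ _ ⟨
    h ^ n * 1#              ≈⟨ *-congˡ (⁻¹-inverseʳ λ ε≈0 → proj₂ 0<ε (≈-sym ε≈0)) ⟨
    h ^ n * (ε * ε ⁻¹)      ≤⟨ *-monoˡ-≤ (0≤h^ n) (*-monoˡ-≤ (<⇒≤ 0<ε) ε⁻¹≤n) ⟩
    h ^ n * (ε * fromℕ n)   ≈⟨ *-Properties.x∙yz≈y∙zx _ _ _ ⟩
    ε * (fromℕ n * h ^ n)   ≤⟨ *-monoˡ-≤ (<⇒≤ 0<ε) (n*h^n≤1 n) ⟩
    ε * 1#                  ≈⟨ *-identityʳ ε ⟩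
    ε                       ∎)

  h^n<ε : ∀ {ε} → 0# < ε → ∃[ n ] h ^ n < ε
  h^n<ε 0<ε with (n , le) ← h^n≤ε 0<ε = suc n , <-≤-trans (h*x<x (0<h^ n)) le

  -- Any denominator of at least c/(r - s) leaves a distance of `c` between its multiples by `s` and
  -- by `r`. A rounded numerator and the later rounding errors are fitted into this room.
  gap : ∀ {s r} → s < r → ∀ c N → ∃[ q ] (N ℕ.≤ suc q × s * fromℕ (suc q) + fromℕ c ≤ r * fromℕ (suc q))
  gap {s} {r} s<r c N with (n , c/d≤n) ← archimedean (fromℕ c * (r - s) ⁻¹) = n ℕ.+ N ,
    ℕ.≤-trans (ℕ.m≤n+m N n) (ℕ.n≤1+n _) , (begin
      s * fromℕ q + fromℕ c                  ≈⟨ +-congˡ (≈-trans (*-congˡ (≈-trans (*-comm _ _) (⁻¹-inverseʳ d≉0))) (*-identityʳ _)) ⟨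
      s * fromℕ q + fromℕ c * (d ⁻¹ * d)     ≈⟨ +-congˡ (*-assoc _ _ _) ⟨
      s * fromℕ q + fromℕ c * d ⁻¹ * d       ≤⟨ +-monoʳ-≤ _ (*-monoʳ-≤ 0≤d (≤-trans c/d≤n
                                                  (fromℕ-mono (ℕ.≤-trans (ℕ.m≤m+n n N) (ℕ.n≤1+n _))))) ⟩
      s * fromℕ q + fromℕ q * d              ≈⟨ +-congˡ (*-comm _ _) ⟩
      s * fromℕ q + d * fromℕ q              ≈⟨ distribʳ _ _ _ ⟨
      (s + d) * fromℕ q                      ≈⟨ *-congʳ s+d≈r ⟩
      r * fromℕ q                            ∎)
    where
    q = suc (n ℕ.+ N)
    d = r - s
    s+d≈r : s + d ≈ r
    s+d≈r = ≈-trans (+-comm s d) (≈-trans (+-assoc r (- s) s) (≈-trans (+-congˡ (-‿inverseˡ s)) (+-identityʳ r)))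
    0≤d : 0# ≤ d
    0≤d = ≤-trans (reflexive (≈-sym (-‿inverseʳ s))) (+-monoˡ-≤ (- s) (<⇒≤ s<r))
    d≉0 : ¬ d ≈ 0#
    d≉0 d≈0 = proj₂ s<r (≈-trans (≈-sym (+-identityʳ s)) (≈-trans (+-congˡ (≈-sym d≈0)) s+d≈r))

  dyadic-bracket : ∀ {x} → 0# < x → x ≤ 1# → ∃[ n ] (h ^ suc n ≤ x × x ≤ h ^ n)
  dyadic-bracket {x} 0<x x≤1 with (n , h^n≤x) ← h^n≤ε 0<x = descend n h^n≤x
    where
    descend : ∀ n → h ^ n ≤ x → ∃[ n ] (h ^ suc n ≤ x × x ≤ h ^ n)
    descend zero    1≤x = 0 , ≤-trans (h^n≤1 1) 1≤x , x≤1
    descend (suc n) le with total x (h ^ n)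
    ... | inj₁ x≤ = n , le , x≤
    ... | inj₂ ≤x = descend n ≤x

-- Masses of cylinders, Kraft's inequality and compactness.

module Mass (em : ExcludedMiddle 0ℓ) (𝓡 : CompleteOrderedField) where

  open CompleteOrderedField 𝓡 renaming (Carrier to ℝ)
  open RealProperties em 𝓡
  open ≤-Reasoning
  open Strings
  open FreePositions using (bump; count)
  open Sum (CommutativeRing.+-commutativeMonoid commutativeRing) using (∑-distrib-+)

  S : ℕ → (ℕ → ℝ) → ℝ
  S n a = sum {n} λ i → a (toℕ i)

  S-mono : ∀ n {a b} → (∀ i → i ℕ.< n → a i ≤ b i) → S n a ≤ S n b
  S-mono zero    le = ≤-refl
  S-mono (suc n) le = +-mono-≤ (le 0 (s≤s z≤n)) (S-mono n λ i i<n → le (suc i) (s≤s i<n))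

  S-+ : ∀ n a b → S n (λ i → a i + b i) ≈ S n a + S n b
  S-+ n a b = ∑-distrib-+ {n} (λ i → a (toℕ i)) (λ i → b (toℕ i))

  S-*ˡ : ∀ n c a → S n (λ i → c * a i) ≈ c * S n a
  S-*ˡ zero    c a = ≈-sym (zeroʳ c)
  S-*ˡ (suc n) c a = ≈-trans (+-congˡ (S-*ˡ n c (a ∘ suc))) (≈-sym (distribˡ c _ _))

  0≤S : ∀ n {a} → (∀ i → 0# ≤ a i) → 0# ≤ S n a
  0≤S zero    0≤a = ≤-refl
  0≤S (suc n) 0≤a = 0≤x+y (0≤a 0) (0≤S n (0≤a ∘ suc))

  S-grow : ∀ {m n a} → (∀ i → 0# ≤ a i) → m ℕ.≤ n → S m a ≤ S n a
  S-grow {n = n} 0≤a z≤n = 0≤S n 0≤a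
  S-grow 0≤a (s≤s m≤n)   = +-monoʳ-≤ _ (S-grow (0≤a ∘ suc) m≤n)

  term≤S : ∀ i {a} → (∀ i → 0# ≤ a i) → a i ≤ S (suc i) a
  term≤S zero    0≤a = ≤-trans (reflexive (≈-sym (+-identityʳ _))) (+-monoʳ-≤ _ (0≤S 0 0≤a))
  term≤S (suc i) {a} 0≤a = begin
    a (suc i)                     ≤⟨ term≤S i (0≤a ∘ suc) ⟩
    S (suc i) (a ∘ suc)           ≈⟨ +-identityˡ _ ⟨
    0# + S (suc i) (a ∘ suc)      ≤⟨ +-monoˡ-≤ _ (0≤a 0) ⟩
    S (suc (suc i)) a             ∎

  S-zero : ∀ n {a} → (∀ i → i ℕ.< n → a i ≤ 0#) → S n a ≤ 0#
  S-zero zero    a≤0 = ≤-refl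
  S-zero (suc n) a≤0 = ≤-trans (+-mono-≤ (a≤0 0 (s≤s z≤n)) (S-zero n λ i i<n → a≤0 (suc i) (s≤s i<n)))
                               (reflexive (+-identityʳ 0#))

  S-single : ∀ n {a v} (A : ℕ → Set) → 0# ≤ v → (∀ i j → A i → A j → i ≡ j) →
             (∀ i → i ℕ.< n → a i ≤ v) → (∀ i → i ℕ.< n → ¬ A i → a i ≤ 0#) → S n a ≤ v
  S-single zero    A 0≤v unique le le0 = 0≤v
  S-single (suc n) {a} {v} A 0≤v unique le le0 with em {A 0}
  ... | yes A0 = ≤-trans
    (+-mono-≤ (le 0 (s≤s z≤n)) (S-zero n λ i i<n → le0 (suc i) (s≤s i<n) λ Ai → ℕ.0≢1+n (unique 0 (suc i) A0 Ai)))
    (reflexive (+-identityʳ v))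
  ... | no ¬A0 = ≤-trans
    (+-mono-≤ (le0 0 (s≤s z≤n) ¬A0)
      (S-single n (A ∘ suc) 0≤v (λ i j Ai Aj → ℕ.suc-injective (unique (suc i) (suc j) Ai Aj))
        (λ i i<n → le (suc i) (s≤s i<n)) (λ i i<n → le0 (suc i) (s≤s i<n))))
    (reflexive (+-identityˡ v))

  S-h^≤1 : ∀ n → S n (λ i → h ^ suc i) ≤ 1#
  S-h^≤1 zero    = 0≤1
  S-h^≤1 (suc n) = begin
    h * 1# + S n (λ i → h * h ^ suc i)  ≈⟨ +-congˡ (S-*ˡ n h (λ i → h ^ suc i)) ⟩
    h * 1# + h * S n (λ i → h ^ suc i)  ≤⟨ +-monoʳ-≤ _ (*-monoˡ-≤ 0≤h (S-h^≤1 n)) ⟩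
    h * 1# + h * 1#                     ≈⟨ h*x+h*x≈x 1# ⟩
    1#                                  ∎

  weight : Bool → Bool → ℝ
  weight true  _     = h
  weight false true  = 0#
  weight false false = 1#

  0≤weight : ∀ a b → 0# ≤ weight a b
  0≤weight true  _     = 0≤h
  0≤weight false true  = ≤-refl
  0≤weight false false = 0≤1

  weight-total : ∀ a x → x ≈ weight a false * x + weight a true * x
  weight-total true  x = ≈-sym (h*x+h*x≈x x)
  weight-total false x = ≈-sym (≈-trans (+-cong (*-identityˡ x) (zeroˡ x)) (+-identityʳ x))

  -- The measure of ⟦ σ ⟧ when the bits at the positions in F are independent
  -- and uniform, and the remaining bits are false.
  mass : (ℕ → Bool) → String → ℝ
  mass F []      = 1#
  mass F (b ∷ σ) = weight (F 0) b * mass (F ∘ suc) σ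

  -- The measure of ⟦ σ ⟧ ∩ ⟦ τ ⟧.
  meet : (ℕ → Bool) → String → String → ℝ
  meet F []          τ           = mass F τ
  meet F (a ∷ σ)     []          = mass F (a ∷ σ)
  meet F (true ∷ σ)  (true ∷ τ)  = weight (F 0) true * meet (F ∘ suc) σ τ
  meet F (false ∷ σ) (false ∷ τ) = weight (F 0) false * meet (F ∘ suc) σ τ
  meet F (true ∷ σ)  (false ∷ τ) = 0#
  meet F (false ∷ σ) (true ∷ τ)  = 0#

  0≤mass : ∀ F σ → 0# ≤ mass F σ
  0≤mass F []      = 0≤1
  0≤mass F (b ∷ σ) = *-nonNegative (0≤weight (F 0) b) (0≤mass (F ∘ suc) σ)

  0≤meet : ∀ F σ τ → 0# ≤ meet F σ τ
  0≤meet F []          τ           = 0≤mass F τ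
  0≤meet F (a ∷ σ)     []          = 0≤mass F (a ∷ σ)
  0≤meet F (true ∷ σ)  (true ∷ τ)  = *-nonNegative (0≤weight (F 0) true) (0≤meet (F ∘ suc) σ τ)
  0≤meet F (false ∷ σ) (false ∷ τ) = *-nonNegative (0≤weight (F 0) false) (0≤meet (F ∘ suc) σ τ)
  0≤meet F (true ∷ σ)  (false ∷ τ) = ≤-refl
  0≤meet F (false ∷ σ) (true ∷ τ)  = ≤-refl

  meet-[]ʳ : ∀ F σ → meet F σ [] ≡ mass F σ
  meet-[]ʳ F []      = ≡.refl
  meet-[]ʳ F (_ ∷ _) = ≡.refl

  meet-refl : ∀ F σ → meet F σ σ ≈ mass F σ
  meet-refl F []          = ≈-refl
  meet-refl F (true ∷ σ)  = *-congˡ (meet-refl (F ∘ suc) σ)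
  meet-refl F (false ∷ σ) = *-congˡ (meet-refl (F ∘ suc) σ)

  scale-split : ∀ {c x y z} → x ≈ y + z → c * x ≈ c * y + c * z
  scale-split eq = ≈-trans (*-congˡ eq) (distribˡ _ _ _)

  mass-split : ∀ F τ → mass F τ ≈ mass F (τ ∷ʳ false) + mass F (τ ∷ʳ true)
  mass-split F []      = weight-total (F 0) 1#
  mass-split F (b ∷ τ) = scale-split (mass-split (F ∘ suc) τ)

  meet-split : ∀ F σ τ → meet F σ τ ≈ meet F σ (τ ∷ʳ false) + meet F σ (τ ∷ʳ true)
  meet-split F []          τ  = mass-split F τ
  meet-split F (true ∷ σ)  [] =
    ≈-sym (≈-trans (+-identityˡ _) (*-congˡ (≡⇒≈ (meet-[]ʳ (F ∘ suc) σ))))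
  meet-split F (false ∷ σ) [] =
    ≈-sym (≈-trans (+-identityʳ _) (*-congˡ (≡⇒≈ (meet-[]ʳ (F ∘ suc) σ))))
  meet-split F (true ∷ σ)  (true ∷ τ)  = scale-split (meet-split (F ∘ suc) σ τ)
  meet-split F (false ∷ σ) (false ∷ τ) = scale-split (meet-split (F ∘ suc) σ τ)
  meet-split F (true ∷ σ)  (false ∷ τ) = ≈-sym (+-identityʳ 0#)
  meet-split F (false ∷ σ) (true ∷ τ)  = ≈-sym (+-identityʳ 0#)

  weight≤1 : ∀ a b → weight a b ≤ 1#
  weight≤1 true  _     = h≤1
  weight≤1 false true  = 0≤1
  weight≤1 false false = ≤-refl

  mass≤1 : ∀ F σ → mass F σ ≤ 1#
  mass≤1 F []      = ≤-refl
  mass≤1 F (b ∷ σ) = ≤-trans (*-mono-≤ (0≤weight (F 0) b) 0≤1 (weight≤1 (F 0) b) (mass≤1 (F ∘ suc) σ))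
                             (reflexive (*-identityˡ 1#))

  meet≤mass : ∀ F σ τ → meet F σ τ ≤ mass F τ
  meet≤mass F []          τ           = ≤-refl
  meet≤mass F (a ∷ σ)     []          = mass≤1 F (a ∷ σ)
  meet≤mass F (true ∷ σ)  (true ∷ τ)  = *-monoˡ-≤ (0≤weight (F 0) true) (meet≤mass (F ∘ suc) σ τ)
  meet≤mass F (false ∷ σ) (false ∷ τ) = *-monoˡ-≤ (0≤weight (F 0) false) (meet≤mass (F ∘ suc) σ τ)
  meet≤mass F (true ∷ σ)  (false ∷ τ) = 0≤mass F (false ∷ τ)
  meet≤mass F (false ∷ σ) (true ∷ τ)  = 0≤mass F (true ∷ τ)

  meet-disjoint : ∀ F σ τ → length σ ℕ.≤ length τ → ¬ Prefix _≡_ σ τ → meet F σ τ ≤ 0#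
  meet-disjoint F []          τ           _        ¬p = contradiction [] ¬p
  meet-disjoint F (true ∷ σ)  (true ∷ τ)  (s≤s le) ¬p = ≤-trans
    (*-monoˡ-≤ (0≤weight (F 0) true) (meet-disjoint (F ∘ suc) σ τ le λ p → ¬p (≡.refl ∷ p))) (reflexive (zeroʳ _))
  meet-disjoint F (false ∷ σ) (false ∷ τ) (s≤s le) ¬p = ≤-trans
    (*-monoˡ-≤ (0≤weight (F 0) false) (meet-disjoint (F ∘ suc) σ τ le λ p → ¬p (≡.refl ∷ p))) (reflexive (zeroʳ _))
  meet-disjoint F (true ∷ σ)  (false ∷ τ) _        _  = ≤-refl
  meet-disjoint F (false ∷ σ) (true ∷ τ)  _        _  = ≤-refl

  length-∷ʳ : ∀ (τ : String) b → length (τ ∷ʳ b) ≡ suc (length τ)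
  length-∷ʳ τ b = ≡.trans (length-++ τ) (ℕ.+-comm (length τ) 1)

  -- After `d` splittings τ is at least as long as the first `N` strings. Then only prefixes of τ
  -- meet it in positive mass, and an antichain contains at most one of these.
  antichain-mass : ∀ F (σ : ℕ → String) → (∀ i j → Prefix _≡_ (σ i) (σ j) → i ≡ j) →
                   ∀ N d τ → (∀ i → i ℕ.< N → length (σ i) ℕ.≤ length τ ℕ.+ d) →
                   S N (λ i → meet F (σ i) τ) ≤ mass F τ
  antichain-mass F σ antichain N zero τ short =
    S-single N (λ i → Prefix _≡_ (σ i) τ) (0≤mass F τ) unique
      (λ i _ → meet≤mass F (σ i) τ)
      (λ i i<N → meet-disjoint F (σ i) τ (ℕ.≤-trans (short i i<N) (ℕ.≤-reflexive (ℕ.+-identityʳ _))))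
    where
    unique : ∀ i j → Prefix _≡_ (σ i) τ → Prefix _≡_ (σ j) τ → i ≡ j
    unique i j p q with prefixes-comparable p q
    ... | is-prefix r = antichain i j r
    ... | has-prefix r = ≡.sym (antichain j i r)
  antichain-mass F σ antichain N (suc d) τ short = begin
    S N (λ i → meet F (σ i) τ)
      ≤⟨ S-mono N (λ i _ → reflexive (meet-split F (σ i) τ)) ⟩
    S N (λ i → meet F (σ i) (τ ∷ʳ false) + meet F (σ i) (τ ∷ʳ true))
      ≈⟨ S-+ N (λ i → meet F (σ i) (τ ∷ʳ false)) (λ i → meet F (σ i) (τ ∷ʳ true)) ⟩
    S N (λ i → meet F (σ i) (τ ∷ʳ false)) + S N (λ i → meet F (σ i) (τ ∷ʳ true))
      ≤⟨ +-mono-≤ (half-of false) (half-of true) ⟩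
    mass F (τ ∷ʳ false) + mass F (τ ∷ʳ true)
      ≈⟨ mass-split F τ ⟨
    mass F τ ∎
    where
    half-of : ∀ b → S N (λ i → meet F (σ i) (τ ∷ʳ b)) ≤ mass F (τ ∷ʳ b)
    half-of b = antichain-mass F σ antichain N d (τ ∷ʳ b) λ i i<N → ℕ.≤-trans (short i i<N)
      (ℕ.≤-reflexive (≡.trans (ℕ.+-suc (length τ) d) (≡.cong (ℕ._+ d) (≡.sym (length-∷ʳ τ b)))))

  bounded : ∀ (a : ℕ → ℕ) N → ∃[ d ] (∀ i → i ℕ.< N → a i ℕ.≤ d)
  bounded a zero    = 0 , λ _ ()
  bounded a (suc N) with (d , le) ← bounded (a ∘ suc) N = a 0 ℕ.+ d , λ where
    zero    _         → ℕ.m≤m+n (a 0) d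
    (suc i) (s≤s i<N) → ℕ.≤-trans (le i i<N) (ℕ.m≤n+m d (a 0))

  mass-everywhere : ∀ σ → mass (λ _ → true) σ ≡ h ^ length σ
  mass-everywhere []      = ≡.refl
  mass-everywhere (_ ∷ σ) = ≡.cong (h *_) (mass-everywhere σ)

  -- With every position free, `mass` is the uniform measure, for which the cylinders of an
  -- antichain are disjoint parts of the whole space.
  kraft : (σ : ℕ → String) → (∀ i j → Prefix _≡_ (σ i) (σ j) → i ≡ j) →
          ∀ N → S N (λ i → h ^ length (σ i)) ≤ 1#
  kraft σ antichain N with (d , short) ← bounded (length ∘ σ) N = ≤-trans
    (S-mono N λ i _ → reflexive (≡⇒≈ (≡.sym (≡.trans (meet-[]ʳ _ (σ i)) (mass-everywhere (σ i))))))
    (antichain-mass (λ _ → true) σ antichain N d [] short)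

  -- Equality can fail only by a `true` at a non-free position, which makes the mass zero.
  mass≤h^count : ∀ F σ → mass F σ ≤ h ^ count F (length σ)
  mass≤h^count F []      = ≤-refl
  mass≤h^count F (b ∷ σ) = go (F 0) b
    where
    go : ∀ a b → weight a b * mass (F ∘ suc) σ ≤ h ^ bump a (count (F ∘ suc) (length σ))
    go true  _     = *-monoˡ-≤ 0≤h (mass≤h^count (F ∘ suc) σ)
    go false false = ≤-trans (reflexive (*-identityˡ _)) (mass≤h^count (F ∘ suc) σ)
    go false true  = ≤-trans (reflexive (zeroˡ _)) (0≤h^ (count (F ∘ suc) (length σ)))

  mass-non-free : ∀ F x n i → i ℕ.< n → F i ≡ false → x i ≡ true → mass F (x ↾ n) ≤ 0#
  mass-non-free F x (suc n) zero _ F0 x0 rewrite F0 | x0 = reflexive (zeroˡ _)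
  mass-non-free F x (suc n) (suc i) (s≤s i<n) Fi xi = ≤-trans
    (*-monoˡ-≤ (0≤weight (F 0) (x 0)) (mass-non-free (F ∘ suc) (x ∘ suc) n i i<n Fi xi)) (reflexive (zeroʳ _))

  -- A point that avoids every w i is built by descending into a half that no
  -- finite partial sum exhausts; this takes the place of compactness.
  finite-subcover : ∀ (μ : String → ℝ) (w : ℕ → String → ℝ) → (∀ i τ → 0# ≤ w i τ) →
    (∀ τ → μ τ ≈ μ (τ ∷ʳ false) + μ (τ ∷ʳ true)) →
    (∀ i τ → w i τ ≈ w i (τ ∷ʳ false) + w i (τ ∷ʳ true)) →
    (∀ x → (∀ n → 0# < μ (x ↾ n)) → ∃[ i ] ∃[ n ] μ (x ↾ n) ≤ w i (x ↾ n)) →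
    ∃[ N ] μ [] ≤ S N (λ i → w i [])
  finite-subcover μ w 0≤w μ-split w-split cover with em {∃[ N ] μ [] ≤ S N (λ i → w i [])}
  ... | yes found = found
  ... | no none   = contradiction exhausted (not-full (proj₁ (proj₂ hit)))
    where
    Full : String → Set
    Full τ = ∃[ N ] μ τ ≤ S N (λ i → w i τ)

    full : ∀ τ → Full (τ ∷ʳ false) → Full (τ ∷ʳ true) → Full τ
    full τ (M , le) (N , le′) = K , (begin
      μ τ
        ≈⟨ μ-split τ ⟩
      μ (τ ∷ʳ false) + μ (τ ∷ʳ true)
        ≤⟨ +-mono-≤ (≤-trans le (S-grow (λ i → 0≤w i _) (ℕ.m≤m+n M N)))
                    (≤-trans le′ (S-grow (λ i → 0≤w i _) (ℕ.m≤n+m N M))) ⟩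
      S K (λ i → w i (τ ∷ʳ false)) + S K (λ i → w i (τ ∷ʳ true))
        ≈⟨ S-+ K (λ i → w i (τ ∷ʳ false)) (λ i → w i (τ ∷ʳ true)) ⟨
      S K (λ i → w i (τ ∷ʳ false) + w i (τ ∷ʳ true))
        ≤⟨ S-mono K (λ i _ → reflexive (≈-sym (w-split i τ))) ⟩
      S K (λ i → w i τ) ∎)
      where K = M ℕ.+ N

    pick : ∀ τ → ¬ Full τ → ∃[ b ] ¬ Full (τ ∷ʳ b)
    pick τ ¬f with em {Full (τ ∷ʳ false)} | em {Full (τ ∷ʳ true)}
    ... | no ¬f₀ | _      = false , ¬f₀
    ... | _      | no ¬f₁ = true , ¬f₁
    ... | yes f₀ | yes f₁ = contradiction (full τ f₀ f₁) ¬f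

    path : ∀ n → ∃[ τ ] ¬ Full τ
    path zero    = [] , none
    path (suc n) with (τ , ¬f) ← path n with (b , ¬f′) ← pick τ ¬f = τ ∷ʳ b , ¬f′

    x : Cantor
    x n = proj₁ (pick (proj₁ (path n)) (proj₂ (path n)))

    x↾ : ∀ n → x ↾ n ≡ proj₁ (path n)
    x↾ zero    = ≡.refl
    x↾ (suc n) = ≡.trans (≡.sym (applyUpTo-∷ʳ x n)) (≡.cong (_∷ʳ x n) (x↾ n))

    not-full : ∀ n → ¬ Full (x ↾ n)
    not-full n = ≡.subst (λ τ → ¬ Full τ) (≡.sym (x↾ n)) (proj₂ (path n))

    -- The empty sum already suffices for a string on which `μ` is at most zero, so `μ` is positive
    -- along the path. The hypothesis then yields a prefix for which one term, hence a partial sum,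
    -- suffices.
    hit = cover x λ n → ≰⇒> λ μ≤0 → not-full n (0 , μ≤0)

    exhausted : Full (x ↾ proj₁ (proj₂ hit))
    exhausted = suc (proj₁ hit) , ≤-trans (proj₂ (proj₂ hit))
      (term≤S (proj₁ hit) λ i → 0≤w i (x ↾ proj₁ (proj₂ hit)))

-- Suprema, infima and sums in the extended reals.

module ExtendedReals (em : ExcludedMiddle 0ℓ) (𝓡 : CompleteOrderedField) where

  open CompleteOrderedField 𝓡 renaming (Carrier to ℝ)
  open Classical em 𝓡
  open RealProperties em 𝓡
  open Mass em 𝓡
  open ExtremaStrict _<_ using ([_]<⊤±) renaming ([_] to <[_])

  ≤±-trans : ∀ {x y z} → x ≤± y → y ≤± z → x ≤± z
  ≤±-trans = ExtremaNonStrict.≤±-trans _≤_ ≤-trans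

  ≤±-reflexive : ∀ {x y} → x ≈± y → x ≤± y
  ≤±-reflexive = ExtremaNonStrict.≤±-reflexive _≤_ reflexive

  ≤±-antisym : ∀ {x y} → x ≤± y → y ≤± x → x ≈± y
  ≤±-antisym = ExtremaNonStrict.≤±-antisym _≤_ antisym

  inf-lower : ∀ P y → P y → inf P ≤± y
  inf-lower P y py = sup-least _ y λ l lower → lower y py

  inf-greatest : ∀ P l → (∀ y → P y → l ≤± y) → l ≤± inf P
  inf-greatest P l lower = sup-upper _ l lower

  inf-antitone : ∀ {P Q} → P ⊆ Q → inf Q ≤± inf P
  inf-antitone {P} {Q} P⊆Q = inf-greatest P (inf Q) λ y py → inf-lower Q y (P⊆Q py)

  ⨆-least : ∀ a b → (∀ n → a n ≤± b) → ⨆ a ≤± b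
  ⨆-least a b le = sup-least _ b λ where y (n , ≡.refl) → le n

  ⨆-upper : ∀ a n → a n ≤± ⨆ a
  ⨆-upper a n = sup-upper _ (a n) (n , ≡.refl)

  ⨅-greatest : ∀ a l → (∀ n → l ≤± a n) → l ≤± ⨅ a
  ⨅-greatest a l le = inf-greatest _ l λ where y (n , ≡.refl) → le n

  positive : ∀ {v y} → 0# < v → [ v ] ≤± y → [ 0# ] <± y
  positive {y = [ _ ]} 0<v ≤[ v≤y ] = <[ <-≤-trans 0<v v≤y ]
  positive {y = ⊤±}    0<v _        = [ 0# ]<⊤±
  positive {y = ⊥±}    0<v SupremumNonStrict.[ () ]

  not-positive : ∀ {y} → (∀ ε → 0# < ε → y ≤± [ ε ]) → ¬ [ 0# ] <± y
  not-positive {[ v ]} small <[ 0<v ] =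
    <⇒≱ (h*x<x 0<v) ([≤]-injective (small (h * v) (0<x*y 0<h 0<v)))
  not-positive {⊤±} small _ with () ← small 1# 0<1

  -- The bound `b` excludes the case in which `sup⁺` is zero by convention.
  sup⁺-upper : ∀ P y b → 0# ≤ b → (∀ z → P z → proj₁ z ≤ b) → P y → proj₁ y ≤ proj₁ (sup⁺ P)
  sup⁺-upper P y b 0≤b bound py with em {∃[ b ] (0# ≤ b × (∀ y → P y → proj₁ y ≤ b))}
  ... | no unbounded          = contradiction (b , 0≤b , bound) unbounded
  ... | yes (b′ , 0≤b′ , le) = proj₁ (proj₂ (complete _ _ _)) (proj₁ y) (inj₂ (proj₂ y , py))

  sup⁺-least : ∀ P b → 0# ≤ b → (∀ z → P z → proj₁ z ≤ b) → proj₁ (sup⁺ P) ≤ b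
  sup⁺-least P b 0≤b bound with em {∃[ b ] (0# ≤ b × (∀ y → P y → proj₁ y ≤ b))}
  ... | no _                  = 0≤b
  ... | yes (b′ , 0≤b′ , le) = proj₂ (proj₂ (complete _ _ _)) b λ where
    x (inj₁ x≈0)       → ≤-trans (reflexive x≈0) 0≤b
    x (inj₂ (0≤x , p)) → bound (x , 0≤x) p

  ∑-≤ : ∀ a v → (∀ n → S n (proj₁ ∘ a) ≤ v) → ∑ a ≤± [ v ]
  ∑-≤ a v le = ⨆-least _ [ v ] λ n → ≤[ le n ]

  ∑-≥ : ∀ a v n → v ≤ S n (proj₁ ∘ a) → [ v ] ≤± ∑ a
  ∑-≥ a v n le = ≤±-trans ≤[ le ] (⨆-upper (λ n → [ S n (proj₁ ∘ a) ]) n)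

  H-mono : ∀ f {A B} → A ⊆ B → H f A ≤± H f B
  H-mono f A⊆B = ⨆-least _ _ λ n → ≤±-trans
    (inf-antitone λ (σ , covers , rest) → σ , (λ x Ax → covers x (A⊆B Ax)) , rest)
    (⨆-upper (λ n → premeasure f n _) n)

  <±-≤±-trans : ∀ {x y z} → x <± y → y ≤± z → x <± z
  <±-≤±-trans = ExtremaStrict.<±-transˡ _<_ <-≤-trans

-- Prefix-free complexity and effective dimension.

module Complexity (em : ExcludedMiddle 0ℓ) (𝓡 : CompleteOrderedField) (U : OptimalPrefixFreeMachine) where

  open CompleteOrderedField 𝓡 renaming (Carrier to ℝ)
  open Classical em 𝓡
  open Dimension U
  open OptimalPrefixFreeMachine U
  open RealProperties em 𝓡
  open Mass em 𝓡
  open ExtendedReals em 𝓡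
  open Strings
  open Recursive

  shortest-program : String → String
  shortest-program σ = proj₁ (proj₁ (proj₂ (shortest σ)))

  shortest-program↓ : ∀ σ → machine ⟨ shortest-program σ ⟩↓ σ
  shortest-program↓ σ = proj₁ (proj₂ (proj₁ (proj₂ (shortest σ))))

  length-shortest-program : ∀ σ → length (shortest-program σ) ≡ K σ
  length-shortest-program σ = proj₂ (proj₂ (proj₁ (proj₂ (shortest σ))))

  -- Shortest programs of distinct strings form an antichain: by prefix-freeness a program that is a
  -- prefix of another equals it, and by determinism the two outputs then agree.
  K-kraft : ∀ N → S N (λ i → h ^ K (decode i)) ≤ 1#
  K-kraft N = ≤-trans
    (S-mono N λ i _ → reflexive (≡⇒≈ (≡.cong (h ^_) (≡.sym (length-shortest-program (decode i))))))
    (kraft (shortest-program ∘ decode) antichain N)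
    where
    antichain : ∀ i j → Prefix _≡_ (shortest-program (decode i)) (shortest-program (decode j)) → i ≡ j
    antichain i j p = ≡.trans (≡.sym (code-decode i)) (≡.trans
      (⇓-deterministic machine
        (≡.subst (λ τ → machine ⟨ τ ⟩↓ decode i)
          (prefixFree _ _ (decode i) (decode j) (shortest-program↓ (decode i)) (shortest-program↓ (decode j)) p)
          (shortest-program↓ (decode i)))
        (shortest-program↓ (decode j)))
      (code-decode j))

  K-≤ : ∀ M → PrefixFree M → ∃[ c ] (∀ τ σ → M ⟨ τ ⟩↓ σ → K σ ℕ.≤ length τ ℕ.+ c)
  K-≤ M pf with (c , simulate) ← optimal M pf = c , λ τ σ p →
    let (τ′ , p′ , le) = simulate τ σ p
    in ℕ.≤-trans (proj₂ (proj₂ (shortest σ)) (length τ′) (τ′ , p′ , ≡.refl)) le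

  ↾-pad : ∀ (x : Cantor) a b → (∀ i → a ℕ.≤ i → i ℕ.< a ℕ.+ b → x i ≡ false) →
          x ↾ (a ℕ.+ b) ≡ (x ↾ a) ++ replicate b false
  ↾-pad x zero    zero    _    = ≡.refl
  ↾-pad x zero    (suc b) zero≡ =
    ≡.cong₂ _∷_ (zero≡ 0 z≤n (s≤s z≤n)) (↾-pad (x ∘ suc) 0 b λ i _ i<b → zero≡ (suc i) z≤n (s≤s i<b))
  ↾-pad x (suc a) b       zero≡ =
    ≡.cong (x 0 ∷_) (↾-pad (x ∘ suc) a b λ i a≤i i<a+b → zero≡ (suc i) (s≤s a≤i) (s≤s i<a+b))

  -- The header 0ʷ1 accounts for the step from `P` to `suc P`. The constant depends on `P` and `Q`
  -- only, so a large `w` outweighs it.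
  K-padded : ∀ P Q → 1 ℕ.≤ P → P ℕ.≤ Q → ∃[ c ] (∀ w (x : Cantor) →
             (∀ i → P ℕ.* suc w ℕ.≤ i → i ℕ.< Q ℕ.* suc w → x i ≡ false) →
             K (x ↾ (Q ℕ.* suc w)) ℕ.≤ suc P ℕ.* suc w ℕ.+ c)
  K-padded P Q 1≤P P≤Q with (c , le) ← K-≤ (Padding.paddingR P Q) (Padding.paddingR-prefixFree P Q 1≤P) = c , λ w x zero≡ →
    let ρ     = x ↾ (P ℕ.* suc w)
        |ρ|   = length-applyUpTo x (P ℕ.* suc w)
        split : P ℕ.* suc w ℕ.+ (Q ℕ.∸ P) ℕ.* suc w ≡ Q ℕ.* suc w
        split = ≡.trans (≡.sym (ℕ.*-distribʳ-+ (suc w) P (Q ℕ.∸ P))) (≡.cong (ℕ._* suc w) (ℕ.m+[n∸m]≡n P≤Q))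
        x↾≡   = ≡.trans (≡.cong (x ↾_) (≡.sym split))
                  (↾-pad x (P ℕ.* suc w) ((Q ℕ.∸ P) ℕ.* suc w) λ i lo hi →
                    zero≡ i lo (≡.subst (i ℕ.<_) split hi))
    in ≡.subst₂ (λ σ n → K σ ℕ.≤ n ℕ.+ c) (≡.sym x↾≡) (length-program w ρ |ρ|)
         (le (program w ρ) _ (⟨program⟩↓ P≤Q w ρ |ρ|))
    where open Padding P Q using (program; length-program; ⟨program⟩↓)

  K/ : Cantor → ℕ → ℝ±
  K/ x n = [ fromℕ (K (x ↾ suc n)) / suc n ]

  ≤-dim : ∀ {x t} N → (∀ n → N ℕ.≤ n → t * fromℕ (suc n) ≤ fromℕ (K (x ↾ suc n))) → [ t ] ≤± dim x
  ≤-dim {x} {t} N le = ≤±-trans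
    (⨅-greatest (λ k → K/ x (N ℕ.+ k)) [ t ] λ k → ≤[ ≤-/ (N ℕ.+ k) (le (N ℕ.+ k) (ℕ.m≤m+n N k)) ])
    (⨆-upper (λ n → ⨅ λ k → K/ x (n ℕ.+ k)) N)

  dim-≤ : ∀ {x s} → (∀ t → s < t → ∀ N → ∃[ n ] (N ℕ.≤ n × fromℕ (K (x ↾ suc n)) < t * fromℕ (suc n))) →
          dim x ≤± [ s ]
  dim-≤ {x} {s} often = ⨆-least _ [ s ] λ N → sup-least _ [ s ] λ where
      ⊥±    lower → ⊥±≤ [ s ]
      [ t ] lower → ≤[ bounds N t (λ k → [≤]-injective (lower _ (k , ≡.refl))) ]
      ⊤±    lower → contradiction (lower (K/ x (N ℕ.+ 0)) (0 , ≡.refl)) λ ()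
    where
    bounds : ∀ N t → (∀ k → t ≤ fromℕ (K (x ↾ suc (N ℕ.+ k))) / suc (N ℕ.+ k)) → t ≤ s
    bounds N t lower with em {t ≤ s}
    ... | yes t≤s = t≤s
    ... | no t≰s with (n , N≤n , K<) ← often t (≰⇒> t≰s) N
                 with (k , ≡.refl) ← ℕ.m≤n⇒∃[o]m+o≡n N≤n
                 = contradiction (≤-/⁻¹ (N ℕ.+ k) (lower k)) (<⇒≱ K<)

  -- Otherwise the ratios K(x↾n)/n are at least p/q from some point on, and then p/q ≤ dim x ≤ s.
  infinitely-often-compressed : ∀ {x s} → dim x ≤± [ s ] → ∀ p q → s * fromℕ (suc q) < fromℕ p →
    ∀ N → ∃[ n ] (N ℕ.≤ n × K (x ↾ n) ℕ.* suc q ℕ.≤ p ℕ.* n)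
  infinitely-often-compressed {x} {s} dim≤s p q sq<p N
    with em {∃[ n ] (N ℕ.≤ n × K (x ↾ n) ℕ.* suc q ℕ.≤ p ℕ.* n)}
  ... | yes found = found
  ... | no none   = contradiction
    (/-≤⁻¹ q ([≤]-injective (≤±-trans (≤-dim {x} N large) dim≤s))) (<⇒≱ sq<p)
    where
    open ≤-Reasoning
    large : ∀ n → N ℕ.≤ n → fromℕ p / suc q * fromℕ (suc n) ≤ fromℕ (K (x ↾ suc n))
    large n N≤n = *-cancelʳ-≤ (0<fromℕ q) (begin
      fromℕ p / suc q * fromℕ (suc n) * fromℕ (suc q)   ≈⟨ *-Properties.xy∙z≈xz∙y _ _ _ ⟩
      fromℕ p / suc q * fromℕ (suc q) * fromℕ (suc n)   ≈⟨ *-congʳ (/-* (fromℕ p) q) ⟩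
      fromℕ p * fromℕ (suc n)                           ≈⟨ fromℕ-* p (suc n) ⟨
      fromℕ (p ℕ.* suc n)                               ≤⟨ fromℕ-mono (ℕ.≰⇒≥ λ le → none (suc n , ℕ.m≤n⇒m≤1+n N≤n , le)) ⟩
      fromℕ (K (x ↾ suc n) ℕ.* suc q)                   ≈⟨ fromℕ-* (K (x ↾ suc n)) (suc q) ⟩
      fromℕ (K (x ↾ suc n)) * fromℕ (suc q)             ∎)

-- Covers with arbitrarily small sums.

take-↾ : ∀ (x : Cantor) {m n} → m ℕ.≤ n → take m (x ↾ n) ≡ x ↾ m
take-↾ x z≤n       = ≡.refl
take-↾ x (s≤s m≤n) = ≡.cong (x 0 ∷_) (take-↾ (x ∘ suc) m≤n)

m≤[1+m/n]*n : ∀ m n → m ℕ.≤ suc (m ℕ./ suc n) ℕ.* suc n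
m≤[1+m/n]*n m n = ℕ.≤-trans (ℕ.≤-reflexive (ℕ.m≡m%n+[m/n]*n m (suc n)))
  (ℕ.+-monoˡ-≤ (m ℕ./ suc n ℕ.* suc n) (ℕ.<⇒≤ (ℕ.m%n<n m (suc n))))

module NullSets (em : ExcludedMiddle 0ℓ) (𝓡 : CompleteOrderedField) (U : OptimalPrefixFreeMachine) where

  open CompleteOrderedField 𝓡 renaming (Carrier to ℝ)
  open Classical em 𝓡
  open Dimension U
  open RealProperties em 𝓡
  open Mass em 𝓡
  open ExtendedReals em 𝓡
  open Complexity em 𝓡 U
  open Strings

  -- At lengths that are multiples of the denominator q, the power x ^ʳ (P / q)
  -- is an integral power of 1/2, so no roots are needed.
  ^ʳ-bound : ∀ {r} q P → fromℕ P ≤ r * fromℕ (suc q) → ∀ i →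
             proj₁ ((2^- (suc i ℕ.* suc q)) ^ʳ r) ≤ h ^ (suc i ℕ.* P)
  ^ʳ-bound {r} q P P≤rq i = sup⁺-least _ _ (0≤h^ (suc i ℕ.* P)) λ where
      -- The clause for bases of at least 1 cannot apply, because the base is at most 1/2.
      (y , 0≤y) (p′ , q′ , inj₁ (1≤x , _) , _)    → contradiction
        (≤-trans 1≤x (≤-trans (h^-anti {1} {n} (s≤s z≤n)) (reflexive (*-identityʳ h))))
        (<⇒≱ (≤-<-trans (reflexive (≈-sym (*-identityʳ h))) (h*x<x 0<1)))
      (y , 0≤y) (p′ , q′ , inj₂ (_ , r≤p′/q′) , y^q′≤) → ^-cancel-≤ q′ (0≤h^ (suc i ℕ.* P)) (begin
        y ^ suc q′                        ≤⟨ y^q′≤ ⟩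
        (h ^ n) ^ p′                      ≈⟨ ^-assocʳ h n p′ ⟩
        h ^ (n ℕ.* p′)                    ≤⟨ h^-anti (exponents p′ q′ (≤-/⁻¹ q′ r≤p′/q′)) ⟩
        h ^ (suc i ℕ.* P ℕ.* suc q′)      ≈⟨ ^-assocʳ h (suc i ℕ.* P) (suc q′) ⟨
        (h ^ (suc i ℕ.* P)) ^ suc q′      ∎)
    where
    open ≤-Reasoning
    n = suc i ℕ.* suc q
    exponents : ∀ p′ q′ → r * fromℕ (suc q′) ≤ fromℕ p′ → suc i ℕ.* P ℕ.* suc q′ ℕ.≤ n ℕ.* p′
    exponents p′ q′ le = ℕ.≤-trans (ℕ.≤-reflexive (ℕ.*-assoc (suc i) P (suc q′)))
      (ℕ.≤-trans (ℕ.*-monoʳ-≤ (suc i) (fromℕ-cancel-≤ (begin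
        fromℕ (P ℕ.* suc q′)                  ≈⟨ fromℕ-* P (suc q′) ⟩
        fromℕ P * fromℕ (suc q′)              ≤⟨ *-monoʳ-≤ (fromℕ-nonNegative (suc q′)) P≤rq ⟩
        r * fromℕ (suc q) * fromℕ (suc q′)    ≈⟨ *-Properties.xy∙z≈xz∙y _ _ _ ⟩
        r * fromℕ (suc q′) * fromℕ (suc q)    ≤⟨ *-monoʳ-≤ (fromℕ-nonNegative (suc q)) le ⟩
        fromℕ p′ * fromℕ (suc q)              ≈⟨ *-comm _ _ ⟩
        fromℕ (suc q) * fromℕ p′              ≈⟨ fromℕ-* (suc q) p′ ⟨
        fromℕ (suc q ℕ.* p′)                  ∎)))
      (ℕ.≤-reflexive (≡.sym (ℕ.*-assoc (suc i) (suc q) p′))))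

  H-vanishes : ∀ (f : ℝ⁺ → ℝ⁺) {s r} → 0# ≤ s → s < r → f ≤* (λ x → x ^ʳ r) → ¬ [ 0# ] <± H f (𝓓≤ s)
  H-vanishes f {s} {r} 0≤s s<r (δ , 0<δ , f≤)
    -- A room of 2 gives consecutive integers with s q < p and p + 1 ≤ r q. The fraction p/q becomes
    -- the complexity threshold t, and (p+1)/q the exponent used in place of `r`.
    with (q , _ , sq+2≤rq) ← gap s<r 2 0
    with (p , sq<p , p≤sq+1) ← next-integer (*-nonNegative 0≤s (fromℕ-nonNegative (suc q)))
    with (N , h^N<δ) ← h^n<ε 0<δ
    = not-positive λ ε 0<ε → ⨆-least _ _ λ n → premeasure-small n ε 0<ε
    where
    open ≤-Reasoning

    P≤rq : fromℕ (suc p) ≤ r * fromℕ (suc q)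
    P≤rq = begin
      1# + fromℕ p                       ≤⟨ +-monoʳ-≤ 1# p≤sq+1 ⟩
      1# + (s * fromℕ (suc q) + 1#)      ≈⟨ +-Properties.x∙yz≈y∙xz _ _ _ ⟩
      s * fromℕ (suc q) + (1# + 1#)      ≈⟨ +-congˡ (+-congˡ (+-identityʳ 1#)) ⟨
      s * fromℕ (suc q) + fromℕ 2        ≤⟨ sq+2≤rq ⟩
      r * fromℕ (suc q)                  ∎

    f-bound : ∀ i n → N ℕ.< i → n ≡ i ℕ.* suc q → proj₁ (f (2^- n)) ≤ h ^ (i ℕ.* suc p)
    f-bound (suc i) n N<i ≡.refl = ≤-trans
      (f≤ (2^- (suc i ℕ.* suc q)) (0<h^ (suc i ℕ.* suc q))
        (≤-<-trans (h^-anti (ℕ.≤-trans (ℕ.<⇒≤ N<i) (ℕ.m≤m*n (suc i) (suc q)))) h^N<δ))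
      (^ʳ-bound q (suc p) P≤rq i)

    module _ (n : ℕ) (ε : ℝ) (0<ε : 0# < ε) where

      -- Two series, each with sum at most 1, are multiplied by `h ^ K₀`, so `h ^ k` has to be at
      -- most ε/2. The other summands give strings of length at least `n` that are long enough for
      -- the bound on `f`.
      k K₀ : ℕ
      k  = proj₁ (h^n≤ε (0<x*y 0<h 0<ε))
      K₀ = k ℕ.+ (suc N ℕ.+ n)

      N<K₀ : N ℕ.< K₀
      N<K₀ = ℕ.≤-trans (ℕ.m≤m+n (suc N) n) (ℕ.m≤n+m _ k)

      n≤K₀ : n ℕ.≤ K₀
      n≤K₀ = ℕ.≤-trans (ℕ.m≤n+m n (suc N)) (ℕ.m≤n+m _ k)

      -- The bound on the length makes its quotient i by q at least p + K₀. Hence K₀ + p(i+1) ≤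
      -- i(p+1), which saves the factor `h ^ K₀` even after the length is rounded down to i q.
      Compressed : String → Set
      Compressed σ = (p ℕ.+ K₀) ℕ.* suc q ℕ.≤ length σ × K σ ℕ.* suc q ℕ.≤ p ℕ.* length σ

      term : ℕ → ℝ
      term j = h ^ K₀ * (h ^ K (decode j) + h ^ suc j)

      -- A cover needs a string for every index. A compressed string is cut to a multiple of q,
      -- where `f` is under control; every other index receives a string of zeros so long that a
      -- geometric series bounds the contributions.
      element : ∀ j → ∃[ ρ ] (n ℕ.≤ length ρ × proj₁ (f (2^- length ρ)) ≤ term j ×
                (∀ x → Compressed (decode j) → x ∈⟦ decode j ⟧ → x ∈⟦ ρ ⟧))
      element j with em {Compressed (decode j)}
      ... | yes (long , compressed) = ρ , n≤|ρ| , f≤term , λ x _ → prefix x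
        where
        σ = decode j
        i = length σ ℕ./ suc q
        ρ = take (i ℕ.* suc q) σ
        iq≤ : i ℕ.* suc q ℕ.≤ length σ
        iq≤ = ℕ.m/n*n≤m (length σ) (suc q)
        |ρ| : length ρ ≡ i ℕ.* suc q
        |ρ| = ≡.trans (length-take (i ℕ.* suc q) σ) (ℕ.m≤n⇒m⊓n≡m iq≤)
        p+K₀≤i : p ℕ.+ K₀ ℕ.≤ i
        p+K₀≤i = ℕ.≤-trans (ℕ.≤-reflexive (≡.sym (ℕ.m*n/n≡m (p ℕ.+ K₀) (suc q)))) (ℕ./-monoˡ-≤ (suc q) long)
        K₀≤i : K₀ ℕ.≤ i
        K₀≤i = ℕ.≤-trans (ℕ.m≤n+m K₀ p) p+K₀≤i
        n≤|ρ| : n ℕ.≤ length ρ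
        n≤|ρ| = ℕ.≤-trans (ℕ.≤-trans n≤K₀ K₀≤i)
          (ℕ.≤-trans (ℕ.m≤m*n i (suc q)) (ℕ.≤-reflexive (≡.sym |ρ|)))
        K≤ : K σ ℕ.≤ p ℕ.* suc i
        K≤ = ℕ.*-cancelʳ-≤ (K σ) (p ℕ.* suc i) (suc q) (ℕ.≤-trans compressed
          (ℕ.≤-trans (ℕ.*-monoʳ-≤ p (m≤[1+m/n]*n (length σ) q))
                     (ℕ.≤-reflexive (≡.sym (ℕ.*-assoc p (suc i) (suc q))))))
        exponents : K₀ ℕ.+ K σ ℕ.≤ i ℕ.* suc p
        exponents = ℕ.≤-trans (ℕ.+-monoʳ-≤ K₀ K≤) (ℕ.≤-trans (ℕ.≤-reflexive (≡.trans
            (≡.cong (K₀ ℕ.+_) (ℕ.*-suc p i))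
            (≡.trans (≡.sym (ℕ.+-assoc K₀ p (p ℕ.* i))) (≡.cong (ℕ._+ p ℕ.* i) (ℕ.+-comm K₀ p)))))
          (ℕ.≤-trans (ℕ.+-monoˡ-≤ (p ℕ.* i) p+K₀≤i)
            (ℕ.≤-reflexive (≡.trans (≡.cong (i ℕ.+_) (ℕ.*-comm p i)) (≡.sym (ℕ.*-suc i p))))))
        f≤term : proj₁ (f (2^- length ρ)) ≤ term j
        f≤term = begin
          proj₁ (f (2^- length ρ))                 ≤⟨ f-bound i (length ρ) (ℕ.≤-trans N<K₀ K₀≤i) |ρ| ⟩
          h ^ (i ℕ.* suc p)                        ≤⟨ h^-anti exponents ⟩
          h ^ (K₀ ℕ.+ K σ)                         ≈⟨ ^-homo-* h K₀ (K σ) ⟩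
          h ^ K₀ * h ^ K σ                         ≤⟨ *-monoˡ-≤ (0≤h^ K₀) (x≤x+y (0≤h^ (suc j))) ⟩
          h ^ K₀ * (h ^ K σ + h ^ suc j)           ∎
        prefix : ∀ x → x ∈⟦ σ ⟧ → x ∈⟦ ρ ⟧
        prefix x x∈ = ≡.trans (≡.cong (x ↾_) |ρ|) (≡.trans (≡.sym (take-↾ x iq≤))
          (≡.cong (take (i ℕ.* suc q)) x∈))
      ... | no ¬compressed = ρ , n≤|ρ| , f≤term , λ x compressed → contradiction compressed ¬compressed
        where
        i = K₀ ℕ.+ suc j
        ρ = replicate (i ℕ.* suc q) false
        |ρ| : length ρ ≡ i ℕ.* suc q
        |ρ| = length-replicate (i ℕ.* suc q)
        n≤|ρ| : n ℕ.≤ length ρ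
        n≤|ρ| = ℕ.≤-trans (ℕ.≤-trans n≤K₀ (ℕ.m≤m+n K₀ (suc j)))
          (ℕ.≤-trans (ℕ.m≤m*n i (suc q)) (ℕ.≤-reflexive (≡.sym |ρ|)))
        f≤term : proj₁ (f (2^- length ρ)) ≤ term j
        f≤term = begin
          proj₁ (f (2^- length ρ))                     ≤⟨ f-bound i (length ρ) (ℕ.≤-trans N<K₀ (ℕ.m≤m+n K₀ (suc j))) |ρ| ⟩
          h ^ (i ℕ.* suc p)                            ≤⟨ h^-anti (ℕ.m≤m*n i (suc p)) ⟩
          h ^ (K₀ ℕ.+ suc j)                           ≈⟨ ^-homo-* h K₀ (suc j) ⟩
          h ^ K₀ * h ^ suc j                           ≤⟨ *-monoˡ-≤ (0≤h^ K₀) (x≤x+y (0≤h^ (K (decode j)))) ⟩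
          h ^ K₀ * (h ^ suc j + h ^ K (decode j))      ≈⟨ *-congˡ (+-comm _ _) ⟩
          term j                                       ∎

      σ̂ : ℕ → String
      σ̂ j = proj₁ (element j)

      covers : Covers σ̂ (𝓓≤ s)
      covers x x∈ with (L , long , compressed) ← infinitely-often-compressed {x} x∈ p q sq<p ((p ℕ.+ K₀) ℕ.* suc q)
        = j , proj₂ (proj₂ (proj₂ (element j))) x (≡.subst Compressed (≡.sym decode-j) (|x↾L| long , K≤))
                (≡.subst (x ∈⟦_⟧) (≡.sym decode-j) (≡.cong (x ↾_) (length-applyUpTo x L)))
        where
        j = code (x ↾ L)
        decode-j : decode j ≡ x ↾ L
        decode-j = decode-code (x ↾ L)
        |x↾L| : ∀ {m} → m ℕ.≤ L → m ℕ.≤ length (x ↾ L)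
        |x↾L| le = ℕ.≤-trans le (ℕ.≤-reflexive (≡.sym (length-applyUpTo x L)))
        K≤ : K (x ↾ L) ℕ.* suc q ℕ.≤ p ℕ.* length (x ↾ L)
        K≤ = ℕ.≤-trans compressed (ℕ.*-monoʳ-≤ p (|x↾L| ℕ.≤-refl))

      sum-small : ∀ M → S M (λ j → proj₁ (f (2^- length (σ̂ j)))) ≤ ε
      sum-small M = begin
        S M (λ j → proj₁ (f (2^- length (σ̂ j))))           ≤⟨ S-mono M (λ j _ → proj₁ (proj₂ (proj₂ (element j)))) ⟩
        S M term                                            ≈⟨ S-*ˡ M (h ^ K₀) (λ j → h ^ K (decode j) + h ^ suc j) ⟩
        h ^ K₀ * S M (λ j → h ^ K (decode j) + h ^ suc j)   ≈⟨ *-congˡ (S-+ M (λ j → h ^ K (decode j)) (λ j → h ^ suc j)) ⟩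
        h ^ K₀ * (S M (λ j → h ^ K (decode j)) + S M (λ j → h ^ suc j))
                                                            ≤⟨ *-monoˡ-≤ (0≤h^ K₀) (+-mono-≤ (K-kraft M) (S-h^≤1 M)) ⟩
        h ^ K₀ * (1# + 1#)                                  ≤⟨ *-monoʳ-≤ (0≤x+y 0≤1 0≤1) (≤-trans (h^-anti (ℕ.m≤m+n k _))
                                                                 (proj₂ (h^n≤ε (0<x*y 0<h 0<ε)))) ⟩
        h * ε * (1# + 1#)                                   ≈⟨ distribˡ _ _ _ ⟩
        h * ε * 1# + h * ε * 1#                             ≈⟨ +-cong (*-identityʳ _) (*-identityʳ _) ⟩
        h * ε + h * ε                                       ≈⟨ h*x+h*x≈x ε ⟩
        ε                                                   ∎

      premeasure-small : premeasure f n (𝓓≤ s) ≤± [ ε ]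
      premeasure-small = ≤±-trans
        (inf-lower _ _ (σ̂ , covers , (λ j → proj₁ (proj₂ (element j))) , ≡.refl))
        (∑-≤ (λ j → f (2^- length (σ̂ j))) ε sum-small)

-- A lower bound for the measure of `𝓓 s`.

module PositiveMeasure
  (em : ExcludedMiddle 0ℓ) (𝓡 : CompleteOrderedField) (U : OptimalPrefixFreeMachine) where

  open CompleteOrderedField 𝓡 renaming (Carrier to ℝ)
  open Classical em 𝓡
  open Dimension U
  open RealProperties em 𝓡
  open Mass em 𝓡
  open ExtendedReals em 𝓡
  open Complexity em 𝓡 U
  open Strings
  open FreePositions
  open ≤-Reasoning

  -- A base of at most 1 bounds all candidates by 1, so `sup⁺` is a true supremum here.
  ∈-^ʳ : ∀ {x y : ℝ⁺} {r} p q → proj₁ x ≤ 1# → r ≤ fromℕ p / suc q →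
         proj₁ y ^ suc q ≤ proj₁ x ^ p → proj₁ y ≤ proj₁ (x ^ʳ r)
  ∈-^ʳ {x} {y} p q x≤1 r≤p/q le = sup⁺-upper _ y 1# 0≤1
    (λ where (z , _) (p′ , q′ , _ , z^q′≤) → ^-cancel-≤ q′ 0≤1 (begin
               z ^ suc q′        ≤⟨ z^q′≤ ⟩
               proj₁ x ^ p′      ≤⟨ ^-anti-≤ (proj₂ x) x≤1 {0} {p′} z≤n ⟩
               1#                ≈⟨ 1^ (suc q′) ⟨
               1# ^ suc q′       ∎))
    (p , q , inj₂ (x≤1 , r≤p/q) , le)
    where
    1^ : ∀ n → 1# ^ n ≈ 1#
    1^ zero    = ≈-refl
    1^ (suc n) = ≈-trans (*-identityˡ _) (1^ n)

  module _ {f : ℝ⁺ → ℝ⁺} (gauge : IsGauge f) (quotient : QuotientDecreasing f)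
           {s : ℝ} (0≤s : 0# ≤ s) (s<1 : s < 1#)
           (not≤* : ∀ r → s < r → r ≤ 1# → ¬ (f ≤* λ x → x ^ʳ r)) where

    φ : ℕ → ℝ
    φ n = proj₁ (f (2^- n))

    0≤φ : ∀ n → 0# ≤ φ n
    0≤φ n = proj₂ (f (2^- n))

    φ-anti : ∀ {m n} → m ℕ.≤ n → φ n ≤ φ m
    φ-anti {m} {n} m≤n = IsGauge.monotone gauge (2^- n) (2^- m) (h^-anti m≤n)

    -- The quotient f(x)/x does not decrease when x passes from 2^-n to 2^-(n+1).
    φ-suc : ∀ n → h * φ n ≤ φ (suc n)
    φ-suc n = begin
      h * φ n                            ≈⟨ *-congʳ (≈-trans (*-congˡ y/y≈1) (*-identityʳ h)) ⟨
      h * (h ^ n * (h ^ n) ⁻¹) * φ n     ≈⟨ *-congʳ (*-assoc h _ _) ⟨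
      h ^ suc n * (h ^ n) ⁻¹ * φ n       ≈⟨ *-assoc _ _ _ ⟩
      h ^ suc n * ((h ^ n) ⁻¹ * φ n)     ≤⟨ *-monoˡ-≤ (0≤h^ (suc n))
                                             (quotient (2^- suc n) (2^- n) (0<h^ (suc n)) (h^-anti (ℕ.n≤1+n n))) ⟩
      h ^ suc n * ((h ^ suc n) ⁻¹ * φ (suc n)) ≈⟨ *-assoc _ _ _ ⟨
      h ^ suc n * (h ^ suc n) ⁻¹ * φ (suc n)   ≈⟨ *-congʳ (⁻¹-inverseʳ (h^≉0 (suc n))) ⟩
      1# * φ (suc n)                     ≈⟨ *-identityˡ _ ⟩
      φ (suc n)                          ∎
      where
      h^≉0 : ∀ n → ¬ h ^ n ≈ 0#
      h^≉0 n eq = proj₂ (0<h^ n) (≈-sym eq)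
      y/y≈1 : h ^ n * (h ^ n) ⁻¹ ≈ 1#
      y/y≈1 = ⁻¹-inverseʳ (h^≉0 n)

    -- A failure of f(x) ≤ x^(p/q) below 2^-N gives x^p ≤ f(x)^(q+1), where q + 1 is the
    -- denominator. Moving from x to the end points of its dyadic interval costs one in the
    -- exponent, hence `suc n` on the left.
    large : ∀ p q → s * fromℕ (suc q) < fromℕ p → p ℕ.≤ suc q → ∀ N →
            ∃[ n ] (N ℕ.≤ n × h ^ (suc n ℕ.* p) ≤ φ n ^ suc q)
    large p q sq<p p≤q N with em {∃[ x ] (0# < proj₁ x × proj₁ x < h ^ N × ¬ proj₁ (f x) ≤ proj₁ (x ^ʳ (fromℕ p / suc q)))}
    ... | no none = contradiction (h ^ N , 0<h^ N , below-power) (not≤* r s<r r≤1)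
      where
      r = fromℕ p / suc q
      s<r : s < r
      s<r = ≰⇒> λ r≤s → <⇒≱ sq<p (/-≤⁻¹ q r≤s)
      r≤1 : r ≤ 1#
      r≤1 = *-cancelʳ-≤ (0<fromℕ q) (begin
        r * fromℕ (suc q)     ≈⟨ /-* (fromℕ p) q ⟩
        fromℕ p               ≤⟨ fromℕ-mono p≤q ⟩
        fromℕ (suc q)         ≈⟨ *-identityˡ _ ⟨
        1# * fromℕ (suc q)    ∎)
      below-power : ∀ x → 0# < proj₁ x → proj₁ x < h ^ N → proj₁ (f x) ≤ proj₁ (x ^ʳ r)
      below-power x 0<x x<h^N with em {proj₁ (f x) ≤ proj₁ (x ^ʳ r)}
      ... | yes le = le
      ... | no nle = contradiction (x , 0<x , x<h^N , nle) none
    ... | yes (x , 0<x , x<h^N , f≰) with (n , h^1+n≤x , x≤h^n) ← dyadic-bracket 0<x (≤-trans (<⇒≤ x<h^N) (h^n≤1 N)) =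
      n , ℕ.≮⇒≥ (λ n<N → <⇒≱ x<h^N (≤-trans (h^-anti n<N) h^1+n≤x)) , (begin
        h ^ (suc n ℕ.* p)         ≈⟨ ^-assocʳ h (suc n) p ⟨
        (h ^ suc n) ^ p           ≤⟨ ^-mono-≤ (0≤h^ (suc n)) h^1+n≤x p ⟩
        proj₁ x ^ p               ≤⟨ <⇒≤ (≰⇒> λ le → f≰ (∈-^ʳ {x} {f x} p q x≤1 ≤-refl le)) ⟩
        proj₁ (f x) ^ suc q       ≤⟨ ^-mono-≤ (proj₂ (f x)) (IsGauge.monotone gauge x (2^- n) x≤h^n) (suc q) ⟩
        φ n ^ suc q               ∎)
      where
      x≤1 : proj₁ x ≤ 1#
      x≤1 = ≤-trans (<⇒≤ x<h^N) (h^n≤1 N)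

    -- The fraction p/(q+1) is the exponent t above `s`. The next numerator will absorb rounding
    -- errors; the fraction with it is still at most 1, as s < 1, and exceeds `s` by at most
    -- 2/(q+1).
    record Approximation (N : ℕ) : Set where
      field
        q p    : ℕ
        N≤q    : N ℕ.≤ suc q
        sq<p   : s * fromℕ (suc q) < fromℕ p
        1+p≤   : fromℕ (suc p) ≤ s * fromℕ (suc q) + fromℕ 2
        1+p≤q  : suc p ℕ.≤ suc q

    approximation : ∀ N → Approximation N
    approximation N
      with (q , N≤q , sq+2≤q) ← gap s<1 2 N
      with (p , sq<p , p≤sq+1) ← next-integer (*-nonNegative 0≤s (fromℕ-nonNegative (suc q)))
      = record
        { q = q ; p = p ; N≤q = N≤q ; sq<p = sq<p ; 1+p≤ = 1+p≤
        ; 1+p≤q = fromℕ-cancel-≤ (≤-trans 1+p≤ (≤-trans sq+2≤q (reflexive (*-identityˡ _))))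
        }
      where
      1+p≤ : fromℕ (suc p) ≤ s * fromℕ (suc q) + fromℕ 2
      1+p≤ = begin
        1# + fromℕ p                      ≤⟨ +-monoʳ-≤ 1# p≤sq+1 ⟩
        1# + (s * fromℕ (suc q) + 1#)     ≈⟨ +-Properties.x∙yz≈y∙xz _ _ _ ⟩
        s * fromℕ (suc q) + (1# + 1#)     ≈⟨ +-congˡ (+-congˡ (+-identityʳ 1#)) ⟨
        s * fromℕ (suc q) + fromℕ 2       ∎

    -- If φ were zero at 0, it would be zero everywhere by monotonicity, whereas `large` gives an n
    -- at which it is positive.
    0<φ0 : 0# < φ 0
    0<φ0 = <-≤-trans (≰⇒> λ φ≤0 → <⇒≱ (0<h^ (suc n ℕ.* p)) (begin
        h ^ (suc n ℕ.* p)       ≤⟨ proj₂ (proj₂ found) ⟩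
        φ n * φ n ^ q           ≤⟨ *-monoʳ-≤ (^-nonNegative (0≤φ n) q) φ≤0 ⟩
        0# * φ n ^ q            ≈⟨ zeroˡ _ ⟩
        0#                      ∎)) (φ-anti {0} {n} z≤n)
      where
      open Approximation (approximation 0)
      found = large p q sq<p (ℕ.≤-trans (ℕ.n≤1+n p) 1+p≤q) 0
      n = proj₁ found

    c : ℕ
    c = proj₁ (h^n≤ε 0<φ0)

    -- The first part bounds the mass of a cylinder of length n with b free positions by 2^c φ(n).
    -- The second will bound the dimension from below.
    Ok : ℕ → ℕ → Set
    Ok n b = h ^ (b ℕ.+ c) ≤ φ n × s * fromℕ n ≤ fromℕ b

    -- In other words, m/e is at most `s` plus 2 over a denominator of at least o, so it is
    -- eventually close to `s`.
    Thin : ℕ → ℕ → ℕ → Set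
    Thin o m e = ∃[ q ] ∃[ p ] (o ℕ.≤ suc q × m ℕ.* suc q ℕ.≤ e ℕ.* p × fromℕ p ≤ s * fromℕ (suc q) + fromℕ 2)

    ok-zero : Ok 0 0
    ok-zero = proj₂ (h^n≤ε 0<φ0) , reflexive (zeroʳ s)

    free-step : ∀ {n b} → Ok n b → Ok (suc n) (suc b)
    free-step {n} {b} (h^≤ , sn≤b) = ≤-trans (*-monoˡ-≤ 0≤h h^≤) (φ-suc n) , (begin
      s * (1# + fromℕ n)      ≈⟨ distribˡ _ _ _ ⟩
      s * 1# + s * fromℕ n    ≤⟨ +-mono-≤ (≤-trans (reflexive (*-identityʳ s)) (<⇒≤ s<1)) sn≤b ⟩
      1# + fromℕ b            ∎)

    antitone : ∀ {m n b} → m ℕ.≤ n → Ok n b → Ok m b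
    antitone m≤n (h^≤ , sn≤b) = ≤-trans h^≤ (φ-anti m≤n) , ≤-trans (*-monoˡ-≤ 0≤s (fromℕ-mono m≤n)) sn≤b

    choose : ∀ n b → Ok n b → ∃[ m ] ∃[ e ] (n ℕ.≤ m × m ℕ.≤ e × n ℕ.< e × Ok e (b ℕ.+ (m ℕ.∸ n)) × Thin n m e)
    choose n b _ = m , e , ℕ.m≤m+n n _ , m≤e , n<e , ok , q , suc p , N≤q , mQ≤ , 1+p≤
      where
      open Approximation (approximation n)
      Q = suc q
      -- The summand b Q ensures b ≤ β. The others are the errors in `[n+β]Q≤`, which the step from
      -- p to p + 1 absorbs.
      found = large p q sq<p (ℕ.≤-trans (ℕ.n≤1+n p) 1+p≤q) (b ℕ.* Q ℕ.+ (n ℕ.* Q ℕ.+ (p ℕ.+ Q)))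
      e = proj₁ found
      bound≤e : b ℕ.* Q ℕ.+ (n ℕ.* Q ℕ.+ (p ℕ.+ Q)) ℕ.≤ e
      bound≤e = proj₁ (proj₂ found)
      -- An integer above (e+1)p/Q, so that the bound from `large` gives `h ^ β` ≤ φ(e). It is to be
      -- the count at `e`, hence the block receives β - b free positions.
      β = suc (suc e ℕ.* p ℕ./ Q)
      m = n ℕ.+ (β ℕ.∸ b)

      1≤p : 1 ℕ.≤ p
      1≤p = ℕ.≮⇒≥ λ p<1 → <⇒≱ sq<p (≤-trans (fromℕ-mono (ℕ.≤-pred p<1))
        (*-nonNegative 0≤s (fromℕ-nonNegative Q)))

      βQ≥ : suc e ℕ.* p ℕ.≤ β ℕ.* Q
      βQ≥ = m≤[1+m/n]*n (suc e ℕ.* p) q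

      βQ≤ : β ℕ.* Q ℕ.≤ Q ℕ.+ suc e ℕ.* p
      βQ≤ = ℕ.+-monoʳ-≤ Q (ℕ.m/n*n≤m (suc e ℕ.* p) Q)

      b≤β : b ℕ.≤ β
      b≤β = ℕ.*-cancelʳ-≤ b β Q (ℕ.≤-trans (ℕ.≤-trans (ℕ.m≤m+n (b ℕ.* Q) _) bound≤e)
        (ℕ.≤-trans (ℕ.n≤1+n e) (ℕ.≤-trans (ℕ.m≤m*n (suc e) p {{ℕ.>-nonZero 1≤p}}) βQ≥)))

      [n+β]Q≤ : (n ℕ.+ β) ℕ.* Q ℕ.≤ e ℕ.* suc p
      [n+β]Q≤ = ℕR.begin
        (n ℕ.+ β) ℕ.* Q                           ℕR.≡⟨ ℕ.*-distribʳ-+ Q n β ⟩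
        n ℕ.* Q ℕ.+ β ℕ.* Q                       ℕR.≤⟨ ℕ.+-monoʳ-≤ (n ℕ.* Q) βQ≤ ⟩
        n ℕ.* Q ℕ.+ (Q ℕ.+ (p ℕ.+ e ℕ.* p))       ℕR.≡⟨ ≡.cong (n ℕ.* Q ℕ.+_) (≡.trans (≡.sym (ℕ.+-assoc Q p _)) (≡.cong (ℕ._+ e ℕ.* p) (ℕ.+-comm Q p))) ⟩
        n ℕ.* Q ℕ.+ (p ℕ.+ Q ℕ.+ e ℕ.* p)         ℕR.≡⟨ ℕ.+-assoc (n ℕ.* Q) _ _ ⟨
        n ℕ.* Q ℕ.+ (p ℕ.+ Q) ℕ.+ e ℕ.* p         ℕR.≤⟨ ℕ.+-monoˡ-≤ (e ℕ.* p) (ℕ.≤-trans (ℕ.m≤n+m _ (b ℕ.* Q)) bound≤e) ⟩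
        e ℕ.+ e ℕ.* p                             ℕR.≡⟨ ℕ.*-suc e p ⟨
        e ℕ.* suc p                               ℕR.∎
        where module ℕR = ℕ.≤-Reasoning

      m≤n+β : m ℕ.≤ n ℕ.+ β
      m≤n+β = ℕ.+-monoʳ-≤ n (ℕ.m∸n≤m β b)

      mQ≤ : m ℕ.* Q ℕ.≤ e ℕ.* suc p
      mQ≤ = ℕ.≤-trans (ℕ.*-monoˡ-≤ Q m≤n+β) [n+β]Q≤

      m≤e : m ℕ.≤ e
      m≤e = ℕ.*-cancelʳ-≤ m e Q (ℕ.≤-trans mQ≤ (ℕ.*-monoʳ-≤ e 1+p≤q))

      n<e : n ℕ.< e
      n<e = ℕ.≤-trans (ℕ.≤-trans (ℕ.≤-reflexive (ℕ.+-comm 1 n))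
              (ℕ.+-mono-≤ (ℕ.m≤m*n n Q) (ℕ.≤-trans 1≤p (ℕ.m≤m+n p Q))))
            (ℕ.≤-trans (ℕ.m≤n+m _ (b ℕ.* Q)) bound≤e)

      h^β≤ : h ^ β ≤ φ e
      h^β≤ = ^-cancel-≤ q (0≤φ e) (begin
        (h ^ β) ^ Q          ≈⟨ ^-assocʳ h β Q ⟩
        h ^ (β ℕ.* Q)        ≤⟨ h^-anti βQ≥ ⟩
        h ^ (suc e ℕ.* p)    ≤⟨ proj₂ (proj₂ found) ⟩
        φ e ^ Q              ∎)

      se≤β : s * fromℕ e ≤ fromℕ β
      se≤β = *-cancelʳ-≤ (0<fromℕ q) (begin
        s * fromℕ e * fromℕ Q       ≈⟨ *-Properties.xy∙z≈xz∙y _ _ _ ⟩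
        s * fromℕ Q * fromℕ e       ≤⟨ *-monoʳ-≤ (fromℕ-nonNegative e) (<⇒≤ sq<p) ⟩
        fromℕ p * fromℕ e           ≈⟨ *-comm _ _ ⟩
        fromℕ e * fromℕ p           ≈⟨ fromℕ-* e p ⟨
        fromℕ (e ℕ.* p)             ≤⟨ fromℕ-mono (ℕ.≤-trans (ℕ.m≤n+m (e ℕ.* p) p) βQ≥) ⟩
        fromℕ (β ℕ.* Q)             ≈⟨ fromℕ-* β Q ⟩
        fromℕ β * fromℕ Q           ∎)

      ok : Ok e (b ℕ.+ (m ℕ.∸ n))
      ok = ≡.subst (Ok e) (≡.sym (≡.trans (≡.cong (b ℕ.+_) (ℕ.m+n∸m≡n n (β ℕ.∸ b))) (ℕ.m+[n∸m]≡n b≤β)))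
        (≤-trans (h^-anti (ℕ.m≤m+n β c)) h^β≤ , se≤β)

    abstract
      free-positions : ∃[ F ] ((∀ n → Ok n (count F n)) × (∀ N → ∃[ o ] ∃[ m ] ∃[ e ]
                       (N ℕ.≤ o × o ℕ.≤ e × m ℕ.≤ e × Thin o m e × (∀ i → m ℕ.≤ i → i ℕ.< e → F i ≡ false))))
      free-positions = F , count-ok , thin-blocks
        where
        open Blocks Ok Thin ok-zero (λ {n} {b} → free-step {n} {b}) (λ {m} {n} {b} → antitone {m} {n} {b}) choose

    F : ℕ → Bool
    F = proj₁ free-positions

    count-ok : ∀ n → Ok n (count F n)
    count-ok = proj₁ (proj₂ free-positions)

    -- Since 2Q ≤ o ≤ Q′, the error 2/Q′ is at most 1/Q, so p′/Q′ ≤ (p+1)/Q: one fixed fraction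
    -- serves all late blocks.
    thin-ratio : ∀ {o m e} Q p → Thin o m e → 2 ℕ.* Q ℕ.≤ o → s * fromℕ Q < fromℕ p → m ℕ.* Q ℕ.≤ e ℕ.* suc p
    thin-ratio {o} {m} {e} Q p (q′ , p′ , o≤Q′ , mQ′≤ , p′≤) 2Q≤o sQ<p = ℕ.*-cancelʳ-≤ _ _ Q′ (ℕR.begin
      m ℕ.* Q ℕ.* Q′             ℕR.≡⟨ ℕ.*-assoc m Q Q′ ⟩
      m ℕ.* (Q ℕ.* Q′)           ℕR.≡⟨ ≡.cong (m ℕ.*_) (ℕ.*-comm Q Q′) ⟩
      m ℕ.* (Q′ ℕ.* Q)           ℕR.≡⟨ ℕ.*-assoc m Q′ Q ⟨
      m ℕ.* Q′ ℕ.* Q             ℕR.≤⟨ ℕ.*-monoˡ-≤ Q mQ′≤ ⟩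
      e ℕ.* p′ ℕ.* Q             ℕR.≡⟨ ℕ.*-assoc e p′ Q ⟩
      e ℕ.* (p′ ℕ.* Q)           ℕR.≤⟨ ℕ.*-monoʳ-≤ e p′Q≤ ⟩
      e ℕ.* (suc p ℕ.* Q′)       ℕR.≡⟨ ℕ.*-assoc e (suc p) Q′ ⟨
      e ℕ.* suc p ℕ.* Q′         ℕR.∎)
      where
      module ℕR = ℕ.≤-Reasoning
      Q′ = suc q′
      p′Q≤ : p′ ℕ.* Q ℕ.≤ suc p ℕ.* Q′
      p′Q≤ = fromℕ-cancel-≤ (begin
        fromℕ (p′ ℕ.* Q)                                     ≈⟨ fromℕ-* p′ Q ⟩
        fromℕ p′ * fromℕ Q                                   ≤⟨ *-monoʳ-≤ (fromℕ-nonNegative Q) p′≤ ⟩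
        (s * fromℕ Q′ + fromℕ 2) * fromℕ Q                   ≈⟨ distribʳ _ _ _ ⟩
        s * fromℕ Q′ * fromℕ Q + fromℕ 2 * fromℕ Q           ≈⟨ +-cong (*-Properties.xy∙z≈xz∙y _ _ _) (≈-sym (fromℕ-* 2 Q)) ⟩
        s * fromℕ Q * fromℕ Q′ + fromℕ (2 ℕ.* Q)             ≤⟨ +-mono-≤ (*-monoʳ-≤ (fromℕ-nonNegative Q′) (<⇒≤ sQ<p))
                                                                         (fromℕ-mono (ℕ.≤-trans 2Q≤o o≤Q′)) ⟩
        fromℕ p * fromℕ Q′ + fromℕ Q′                        ≈⟨ +-comm _ _ ⟩
        fromℕ Q′ + fromℕ p * fromℕ Q′                        ≈⟨ +-congˡ (fromℕ-* p Q′) ⟨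
        fromℕ Q′ + fromℕ (p ℕ.* Q′)                          ≈⟨ fromℕ-+ Q′ (p ℕ.* Q′) ⟨
        fromℕ (suc p ℕ.* Q′)                                 ∎)

    -- The padding machine works at multiples of `Q`, so the end e of a late block is rounded down
    -- to Q(w+1). Then m ≤ (p+1)(w+2), which is at most (p+2)(w+1) because p ≤ w.
    zeros-from : ∀ q p → s * fromℕ (suc q) < fromℕ p → ∀ W → ∃[ w ] (W ℕ.≤ w ×
                 (∀ i → suc (suc p) ℕ.* suc w ℕ.≤ i → i ℕ.< suc q ℕ.* suc w → F i ≡ false))
    zeros-from q p sQ<p W
      with (o , m , e , N≤o , o≤e , _ , thin , F-false) ←
             proj₂ (proj₂ free-positions) (2 ℕ.* suc q ℕ.+ suc (suc p ℕ.+ W) ℕ.* suc q)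
      = w , ℕ.≤-trans (ℕ.m≤n+m W (suc p)) w≥ ,
        λ i lo hi → F-false i (ℕ.≤-trans m≤Pw lo) (ℕ.<-≤-trans hi Qw≤e)
      where
      module ℕR = ℕ.≤-Reasoning
      Q  = suc q
      w⁺ = e ℕ./ Q
      w  = ℕ.pred w⁺
      large-w⁺ : suc (suc p ℕ.+ W) ℕ.≤ w⁺
      large-w⁺ = ℕ.≤-trans (ℕ.≤-reflexive (≡.sym (ℕ.m*n/n≡m (suc (suc p ℕ.+ W)) Q)))
        (ℕ./-monoˡ-≤ Q (ℕ.≤-trans (ℕ.m≤n+m _ (2 ℕ.* Q)) (ℕ.≤-trans N≤o o≤e)))
      w⁺≡ : suc w ≡ w⁺
      w⁺≡ = ℕ.suc-pred w⁺ {{ℕ.>-nonZero (ℕ.≤-trans (s≤s z≤n) large-w⁺)}}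
      w≥ : suc p ℕ.+ W ℕ.≤ w
      w≥ = ℕ.≤-pred (ℕ.≤-trans large-w⁺ (ℕ.≤-reflexive (≡.sym w⁺≡)))

      m≤Pw : m ℕ.≤ suc (suc p) ℕ.* suc w
      m≤Pw = ℕ.*-cancelʳ-≤ m _ Q (ℕR.begin
        m ℕ.* Q                            ℕR.≤⟨ thin-ratio {o} {m} {e} Q p thin (ℕ.≤-trans (ℕ.m≤m+n (2 ℕ.* Q) _) N≤o) sQ<p ⟩
        e ℕ.* suc p                        ℕR.≤⟨ ℕ.*-monoˡ-≤ (suc p) (m≤[1+m/n]*n e q) ⟩
        suc w⁺ ℕ.* Q ℕ.* suc p             ℕR.≡⟨ ≡.cong (λ v → suc v ℕ.* Q ℕ.* suc p) w⁺≡ ⟨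
        suc (suc w) ℕ.* Q ℕ.* suc p        ℕR.≡⟨ ℕ.*-comm _ (suc p) ⟩
        suc p ℕ.* (suc (suc w) ℕ.* Q)      ℕR.≡⟨ ℕ.*-assoc (suc p) (suc (suc w)) Q ⟨
        suc p ℕ.* suc (suc w) ℕ.* Q        ℕR.≡⟨ ≡.cong (ℕ._* Q) (ℕ.*-suc (suc p) (suc w)) ⟩
        (suc p ℕ.+ suc p ℕ.* suc w) ℕ.* Q  ℕR.≤⟨ ℕ.*-monoˡ-≤ Q (ℕ.+-monoˡ-≤ _
                                                 (ℕ.m≤n⇒m≤1+n (ℕ.≤-trans (ℕ.m≤m+n (suc p) W) w≥))) ⟩
        suc (suc p) ℕ.* suc w ℕ.* Q        ℕR.∎)

      Qw≤e : Q ℕ.* suc w ℕ.≤ e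
      Qw≤e = ℕ.≤-trans (ℕ.≤-reflexive (≡.trans (ℕ.*-comm Q (suc w)) (≡.cong (ℕ._* Q) w⁺≡))) (ℕ.m/n*n≤m e Q)

    compressible : ∀ x → (∀ i → F i ≡ false → x i ≡ false) → ∀ t → s < t → t ≤ 1# → ∀ N →
                   ∃[ n ] (N ℕ.≤ n × fromℕ (K (x ↾ suc n)) < t * fromℕ (suc n))
    compressible x xs t s<t t≤1 N
      -- The room of 5 consists of one unit each for rounding s Q up to p, for the fraction (p+1)/Q
      -- of `thin-ratio`, for the rounding in `zeros-from`, for the header of the program and for
      -- the constant of the machine.
      with (q , _ , sQ+5≤tQ) ← gap s<t 5 0
      with (p , sQ<p , p≤sQ+1) ← next-integer (*-nonNegative 0≤s (fromℕ-nonNegative (suc q)))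
      = compress (K-padded P Q (s≤s z≤n) P≤Q)
      where
      module ℕR = ℕ.≤-Reasoning
      Q = suc q
      P = suc (suc p)

      2+P≤tQ : fromℕ (suc (suc P)) ≤ t * fromℕ Q
      2+P≤tQ = begin
        fromℕ (4 ℕ.+ p)                       ≈⟨ fromℕ-+ 4 p ⟩
        fromℕ 4 + fromℕ p                     ≤⟨ +-monoʳ-≤ _ p≤sQ+1 ⟩
        fromℕ 4 + (s * fromℕ Q + 1#)          ≈⟨ +-Properties.x∙yz≈y∙zx _ _ _ ⟩
        s * fromℕ Q + (1# + fromℕ 4)          ≤⟨ sQ+5≤tQ ⟩
        t * fromℕ Q                           ∎

      P≤Q : P ℕ.≤ Q
      P≤Q = ℕ.≤-trans (ℕ.m≤n+m P 2) (fromℕ-cancel-≤ (≤-trans 2+P≤tQ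
        (≤-trans (*-monoʳ-≤ (fromℕ-nonNegative Q) t≤1) (reflexive (*-identityˡ _)))))

      compress : ∃[ d ] (∀ w (x : Cantor) →
                 (∀ i → P ℕ.* suc w ℕ.≤ i → i ℕ.< Q ℕ.* suc w → x i ≡ false) →
                 K (x ↾ (Q ℕ.* suc w)) ℕ.≤ suc P ℕ.* suc w ℕ.+ d) →
                 ∃[ n ] (N ℕ.≤ n × fromℕ (K (x ↾ suc n)) < t * fromℕ (suc n))
      compress (d , K≤) with (w , d+N≤w , zeros) ← zeros-from q p sQ<p (d ℕ.+ N) =
        w ℕ.+ q ℕ.* suc w ,
        ℕ.≤-trans (ℕ.m≤n+m N d) (ℕ.≤-trans d+N≤w (ℕ.m≤m+n w _)) ,
        <-≤-trans (fromℕ-< (K (x ↾ (Q ℕ.* suc w)))) (begin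
          fromℕ (suc (K (x ↾ (Q ℕ.* suc w))))        ≤⟨ fromℕ-mono K< ⟩
          fromℕ (suc (suc P) ℕ.* suc w)              ≈⟨ fromℕ-* (suc (suc P)) (suc w) ⟩
          fromℕ (suc (suc P)) * fromℕ (suc w)        ≤⟨ *-monoʳ-≤ (fromℕ-nonNegative (suc w)) 2+P≤tQ ⟩
          t * fromℕ Q * fromℕ (suc w)                ≈⟨ *-assoc _ _ _ ⟩
          t * (fromℕ Q * fromℕ (suc w))              ≈⟨ *-congˡ (fromℕ-* Q (suc w)) ⟨
          t * fromℕ (Q ℕ.* suc w)                    ∎)
        where
        K< : K (x ↾ (Q ℕ.* suc w)) ℕ.< suc (suc P) ℕ.* suc w
        K< = ℕR.begin
          suc (K (x ↾ (Q ℕ.* suc w)))        ℕR.≤⟨ s≤s (K≤ w x λ i lo hi → xs i (zeros i lo hi)) ⟩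
          suc (suc P ℕ.* suc w ℕ.+ d)        ℕR.≡⟨ ≡.cong suc (ℕ.+-comm _ d) ⟩
          suc d ℕ.+ suc P ℕ.* suc w          ℕR.≤⟨ ℕ.+-monoˡ-≤ _ (s≤s (ℕ.≤-trans (ℕ.m≤m+n d N) d+N≤w)) ⟩
          suc (suc P) ℕ.* suc w              ℕR.∎

    -- The machine pads only if P ≤ Q, which came from t ≤ 1. For larger t the case of 1 is enough,
    -- since s < 1.
    often-compressible : ∀ x → (∀ i → F i ≡ false → x i ≡ false) → ∀ t → s < t → ∀ N →
                         ∃[ n ] (N ℕ.≤ n × fromℕ (K (x ↾ suc n)) < t * fromℕ (suc n))
    often-compressible x xs t s<t N = ⊎.[ (λ t≤1 → compressible x xs t s<t t≤1 N) , above ]′ (total t 1#)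
      where
      above : 1# ≤ t → ∃[ n ] (N ℕ.≤ n × fromℕ (K (x ↾ suc n)) < t * fromℕ (suc n))
      above 1≤t =
        let (n , N≤n , K<) = compressible x xs 1# s<1 ≤-refl N
        in n , N≤n , <-≤-trans K< (*-monoʳ-≤ (fromℕ-nonNegative (suc n)) 1≤t)

    dim≤s : ∀ x → (∀ i → F i ≡ false → x i ≡ false) → dim x ≤± [ s ]
    dim≤s x xs = dim-≤ {x} {s} (often-compressible x xs)

    s≤dim : ∀ x → (∀ n → count F n ℕ.≤ K (x ↾ n)) → [ s ] ≤± dim x
    s≤dim x incompressible = ≤-dim {x} {s} 0 λ n _ → ≤-trans (proj₂ (count-ok (suc n)))
      (fromℕ-mono {count F (suc n)} {K (x ↾ suc n)} (incompressible (suc n)))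

    dim≈s : ∀ x → (∀ i → F i ≡ false → x i ≡ false) → (∀ n → count F n ℕ.≤ K (x ↾ n)) → 𝓓 s x
    dim≈s x xs incompressible = ≤±-antisym {dim x} {[ s ]} (dim≤s x xs) (s≤dim x incompressible)

    zeros : ∀ x → (∀ n → 0# < mass F (x ↾ n)) → ∀ i → F i ≡ false → x i ≡ false
    zeros x 0<mass i Fi≡false = ¬-not λ xi≡true →
      <⇒≱ (0<mass (suc i)) (mass-non-free F x (suc i) i ℕ.≤-refl Fi≡false xi≡true)

    Bad : ℕ → Set
    Bad i = K (decode i) ℕ.< count F (length (decode i))

    Bad? : ∀ i → Dec (Bad i)
    Bad? i = K (decode i) ℕ.<? count F (length (decode i))

    bad-meet : ∀ i → Dec (Bad i) → String → ℝ
    bad-meet i (yes _) τ = meet F (decode i) τ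
    bad-meet i (no _)  τ = 0#

    -- The strict inequality in `Bad` is the source of the factor `h`, by which the bad strings take
    -- at most half of the mass.
    bad-mass : ∀ i (D : Dec (Bad i)) → bad-meet i D [] ≤ h * h ^ K (decode i)
    bad-mass i (no _)    = 0≤h^ (suc (K (decode i)))
    bad-mass i (yes bad) = begin
      meet F (decode i) []                    ≈⟨ ≡⇒≈ (meet-[]ʳ F (decode i)) ⟩
      mass F (decode i)                       ≤⟨ mass≤h^count F (decode i) ⟩
      h ^ count F (length (decode i))         ≤⟨ h^-anti bad ⟩
      h * h ^ K (decode i)                    ∎

    module _ (σ : ℕ → String) (covers : Covers σ (𝓓 s)) where

      -- A point whose prefixes all have positive mass either has a bad prefix or lies in `𝓓 s`,
      -- hence in the cover. Adding the two weights at each index makes one family that catches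
      -- every such point.
      w : ℕ → String → ℝ
      w i τ = meet F (σ i) τ + bad-meet i (Bad? i) τ

      0≤bad-meet : ∀ i (D : Dec (Bad i)) τ → 0# ≤ bad-meet i D τ
      0≤bad-meet i (yes _) τ = 0≤meet F (decode i) τ
      0≤bad-meet i (no _)  τ = ≤-refl

      bad-meet-split : ∀ i (D : Dec (Bad i)) τ → bad-meet i D τ ≈ bad-meet i D (τ ∷ʳ false) + bad-meet i D (τ ∷ʳ true)
      bad-meet-split i (yes _) τ = meet-split F (decode i) τ
      bad-meet-split i (no _)  τ = ≈-sym (+-identityʳ 0#)

      0≤w : ∀ i τ → 0# ≤ w i τ
      0≤w i τ = 0≤x+y (0≤meet F (σ i) τ) (0≤bad-meet i (Bad? i) τ)

      w-split : ∀ i τ → w i τ ≈ w i (τ ∷ʳ false) + w i (τ ∷ʳ true)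
      w-split i τ = ≈-trans (+-cong (meet-split F (σ i) τ) (bad-meet-split i (Bad? i) τ))
        (+-Properties.interchange _ _ _ _)

      bad≤w : ∀ i τ → Bad i → meet F (decode i) τ ≤ w i τ
      bad≤w i τ bad = ≤-trans (meet≤bad (Bad? i))
        (≤-trans (x≤x+y (0≤meet F (σ i) τ)) (reflexive (+-comm _ _)))
        where
        meet≤bad : ∀ D → meet F (decode i) τ ≤ bad-meet i D τ
        meet≤bad (yes _) = ≤-refl
        meet≤bad (no ¬bad) = contradiction bad ¬bad

      covered : ∀ x → (∀ n → 0# < mass F (x ↾ n)) → ∃[ i ] ∃[ n ] mass F (x ↾ n) ≤ w i (x ↾ n)
      covered x 0<mass = by-cases em
        where
        compressed : ∀ n → K (x ↾ n) ℕ.< count F n → ∃[ i ] ∃[ n ] mass F (x ↾ n) ≤ w i (x ↾ n)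
        compressed n K< = i , n , (begin
          mass F (x ↾ n)                ≈⟨ meet-refl F (x ↾ n) ⟨
          meet F (x ↾ n) (x ↾ n)        ≡⟨ ≡.cong (λ ρ → meet F ρ (x ↾ n)) decode-i ⟨
          meet F (decode i) (x ↾ n)     ≤⟨ bad≤w i (x ↾ n) bad ⟩
          w i (x ↾ n)                   ∎)
          where
          i = code (x ↾ n)
          decode-i : decode i ≡ x ↾ n
          decode-i = decode-code (x ↾ n)
          bad : Bad i
          bad = ≡.subst (λ ρ → K ρ ℕ.< count F (length ρ)) (≡.sym decode-i)
            (≡.subst (λ m → K (x ↾ n) ℕ.< count F m) (≡.sym (length-applyUpTo x n)) K<)

        in-cover : ∀ i → x ∈⟦ σ i ⟧ → ∃[ i ] ∃[ n ] mass F (x ↾ n) ≤ w i (x ↾ n)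
        in-cover i x∈ = i , length (σ i) , (begin
          mass F (x ↾ length (σ i))     ≡⟨ ≡.cong (mass F) x∈ ⟩
          mass F (σ i)                  ≈⟨ meet-refl F (σ i) ⟨
          meet F (σ i) (σ i)            ≤⟨ x≤x+y (0≤bad-meet i (Bad? i) (σ i)) ⟩
          w i (σ i)                     ≡⟨ ≡.cong (w i) x∈ ⟨
          w i (x ↾ length (σ i))        ∎)

        by-cases : Dec (∃[ n ] K (x ↾ n) ℕ.< count F n) → ∃[ i ] ∃[ n ] mass F (x ↾ n) ≤ w i (x ↾ n)
        by-cases (yes (n , K<)) = compressed n K<
        by-cases (no none)      =
          let (i , x∈) = covers x (dim≈s x (zeros x 0<mass) λ n → ℕ.≮⇒≥ λ K< → none (n , K<))
          in in-cover i x∈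

      -- Of the total mass 1 the bad strings take at most `h`, so the cover keeps at least `h`; the
      -- factor `h ^ c` is the price of replacing mass by φ.
      partial-sum-large : ∀ N → 1# ≤ S N (λ i → w i []) → h ^ suc c ≤ S N (λ i → φ (length (σ i)))
      partial-sum-large N 1≤ = begin
          h * h ^ c                                   ≈⟨ *-comm _ _ ⟩
          h ^ c * h                                   ≤⟨ *-monoˡ-≤ (0≤h^ c) h≤S ⟩
          h ^ c * S N (λ i → meet F (σ i) [])         ≈⟨ S-*ˡ N (h ^ c) (λ i → meet F (σ i) []) ⟨
          S N (λ i → h ^ c * meet F (σ i) [])         ≤⟨ S-mono N (λ i _ → mass≤φ i) ⟩
          S N (λ i → φ (length (σ i)))                ∎
        where
        mass≤φ : ∀ i → h ^ c * meet F (σ i) [] ≤ φ (length (σ i))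
        mass≤φ i = begin
          h ^ c * meet F (σ i) []                     ≡⟨ ≡.cong (h ^ c *_) (meet-[]ʳ F (σ i)) ⟩
          h ^ c * mass F (σ i)                        ≤⟨ *-monoˡ-≤ (0≤h^ c) (mass≤h^count F (σ i)) ⟩
          h ^ c * h ^ count F (length (σ i))          ≈⟨ *-comm _ _ ⟩
          h ^ count F (length (σ i)) * h ^ c          ≈⟨ ^-homo-* h (count F (length (σ i))) c ⟨
          h ^ (count F (length (σ i)) ℕ.+ c)          ≤⟨ proj₁ (count-ok (length (σ i))) ⟩
          φ (length (σ i))                            ∎
        bad-sum : S N (λ i → bad-meet i (Bad? i) []) ≤ h
        bad-sum = begin
          S N (λ i → bad-meet i (Bad? i) [])          ≤⟨ S-mono N (λ i _ → bad-mass i (Bad? i)) ⟩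
          S N (λ i → h * h ^ K (decode i))            ≈⟨ S-*ˡ N h (λ i → h ^ K (decode i)) ⟩
          h * S N (λ i → h ^ K (decode i))            ≤⟨ *-monoˡ-≤ 0≤h (K-kraft N) ⟩
          h * 1#                                      ≈⟨ *-identityʳ h ⟩
          h                                           ∎
        h≤S : h ≤ S N (λ i → meet F (σ i) [])
        h≤S = +-cancelʳ-≤ h (begin
          h + h                                       ≈⟨ h+h≈1 ⟩
          1#                                          ≤⟨ 1≤ ⟩
          S N (λ i → w i [])                          ≈⟨ S-+ N (λ i → meet F (σ i) []) (λ i → bad-meet i (Bad? i) []) ⟩
          S N (λ i → meet F (σ i) []) + S N (λ i → bad-meet i (Bad? i) [])
                                                      ≤⟨ +-monoʳ-≤ _ bad-sum ⟩
          S N (λ i → meet F (σ i) []) + h             ∎)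

      sum-large : ∃[ N ] h ^ suc c ≤ S N (λ i → φ (length (σ i)))
      sum-large =
        let (N , 1≤) = finite-subcover (mass F) w 0≤w (mass-split F) w-split covered
        in N , partial-sum-large N 1≤

    H-positive : [ 0# ] <± H f (𝓓 s)
    H-positive = positive (0<h^ (suc c)) (≤±-trans
      (inf-greatest _ [ h ^ suc c ] λ where
        _ (σ , covers , _ , ≡.refl) → ∑-≥ (λ i → f (2^- length (σ i))) (h ^ suc c) (proj₁ (sum-large σ covers)) (proj₂ (sum-large σ covers)))
      -- The bound holds for covers by strings of any length, so the premeasure of index 0 is
      -- already positive.
      (⨆-upper (λ n → premeasure f n (𝓓 s)) 0))

theorem2 :
    (em : ExcludedMiddle 0ℓ) (𝓡 : CompleteOrderedField) (U : OptimalPrefixFreeMachine) →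
    let open CompleteOrderedField 𝓡 renaming (Carrier to ℝ)
        open Classical em 𝓡
        open Dimension U
    in
    (f : ℝ⁺ → ℝ⁺) → IsGauge f → QuotientDecreasing f →
    (s : ℝ) → 0# ≤ s → s < 1# →
    ([ 0# ] <± H f (𝓓 s) ⇔ [ 0# ] <± H f (𝓓≤ s)) ×
    ([ 0# ] <± H f (𝓓≤ s) ⇔ (∀ r → s < r → r ≤ 1# → ¬ (f ≤* λ x → x ^ʳ r)))
theorem2 em 𝓡 U f gauge quotient s 0≤s s<1 =
  mk⇔ 1⇒2 (λ H>0 → 3⇒1 (2⇒3 H>0)) , mk⇔ 2⇒3 (λ not≤* → 1⇒2 (3⇒1 not≤*))
  where
  open CompleteOrderedField 𝓡
  open Classical em 𝓡
  open Dimension U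
  open ExtendedReals em 𝓡

  1⇒2 : [ 0# ] <± H f (𝓓 s) → [ 0# ] <± H f (𝓓≤ s)
  1⇒2 H>0 = <±-≤±-trans H>0 (H-mono f λ x∈ → ≤±-reflexive x∈)

  2⇒3 : [ 0# ] <± H f (𝓓≤ s) → ∀ r → s < r → r ≤ 1# → ¬ (f ≤* λ x → x ^ʳ r)
  2⇒3 H>0 r s<r _ f≤* = NullSets.H-vanishes em 𝓡 U f 0≤s s<r f≤* H>0

  3⇒1 : (∀ r → s < r → r ≤ 1# → ¬ (f ≤* λ x → x ^ʳ r)) → [ 0# ] <± H f (𝓓 s)
  3⇒1 = PositiveMeasure.H-positive em 𝓡 U gauge quotient 0≤s s<1
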